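{- Let $G_1$ and $G_2$ be two realizations, on the same labeled vertex set, of the same degree sequence $\mathbf{d}=(d_1,\ldots,d_n)$. Then $$\mathbf{dist}_u(G_1,G_2)=H'(G_1,G_2)-\mathbf{maxC}_u(G_1,G_2).$$
   Context: All graphs are finite, simple and undirected, with labeled vertices $v_1,\dots,v_n$. A graph $G$ realizes a sequence $\mathbf d=(d_1,\dots,d_n)$ of positive integers if $d(v_i)=d_i$ for all $i$. Swap: if $a,b,c,d$ are four different vertices of $G$ with $(a,c),(b,d)\in E(G)$ and $(b,c),(a,d)\notin E(G)$, then a swap replaces $G$ by the graph $G'$ on the same vertex set with $E(G')=E(G)\setminus\{(a,c),(b,d)\}\cup\{(b,c),(a,d)\}$; $G'$ has the same degree sequence. $\mathbf{dist}_u(G_1,G_2)$ is the length (number of swaps) of a shortest sequence of swaps transforming $G_1$ into $G_2$. $H'(G_1,G_2)=|E(G_1)\,\Delta\, E(G_2)|/2$, where $\Delta$ is the symmetric difference. A red-blue graph is a graph with each edge colored red or blue; it is balanced if at each vertex the number of red edges equals the number of blue edges. The balanced red-blue graph associated with $G_1,G_2$ has the common vertex set, edge set $E(G_1)\,\Delta\, E(G_2)$, edges of $E(G_1)\setminus E(G_2)$ colored red and edges of $E(G_2)\setminus E(G_1)$ colored blue. A circuit is a closed trail $v_0,v_1,\dots,v_t=v_0$ (each edge used at most once; vertices may repeat). It is alternating if consecutive edges have different colors, including the last edge $v_{t-1}v_t$ and the first edge $v_0v_1$. The edge set of every balanced red-blue graph $G$ can be decomposed (partitioned) into alternating circuits;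 $\mathbf{maxC}_u(G)$ is the maximum number of circuits in such a decomposition, and $\mathbf{maxC}_u(G_1,G_2)=\mathbf{maxC}_u(G)$ for the associated balanced red-blue graph $G$. -}

module Defs where

open import Data.Bool using (Bool; false; T; T?; if_then_else_; _xor_)
open import Data.Fin using (Fin; _<?_)
open import Data.Fin.Subset using (Subset; ∣_∣)
open import Data.List using (List; []; _∷_; [_]; _++_; length; filter; allFin; cartesianProduct)
open import Data.List.Relation.Unary.AllPairs using (AllPairs)
open import Data.List.Relation.Unary.Any using (Any)
open import Data.List.Relation.Unary.Linked using (Linked)
import Data.List.Membership.Setoid as SetoidMembership
import Data.List.Relation.Binary.Disjoint.Setoid as SetoidDisjoint
import Data.List.Relation.Unary.Unique.Setoid as SetoidUnique
open import Data.List.Relation.Unary.Unique.Propositional using (Unique)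
open import Data.Nat using (ℕ; zero; suc; _≤_; _/_)
open import Data.Product using (_×_; _,_; ∃-syntax)
open import Data.Sum using (_⊎_; inj₁; inj₂)
open import Data.Unit using (⊤)
open import Data.Vec using (tabulate)
open import Function.Bundles using (_⇔_)
open import Level using (0ℓ)
open import Relation.Binary.Bundles using (Setoid)
open import Relation.Binary.PropositionalEquality
  using (_≡_; _≢_; refl; sym; trans; cong; cong₂)
open import Relation.Nullary using (¬_)
open import Relation.Nullary.Decidable using (_×-dec_)

record Graph (n : ℕ) : Set where
  field
    edge        : Fin n → Fin n → Bool
    edge-sym    : ∀ u v → edge u v ≡ edge v u
    edge-irrefl : ∀ v → edge v v ≡ false

open Graph public

private
  variable
    n : ℕ

Adj : Graph n → Fin n → Fin n → Set
Adj G u v = T (edge G u v)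

-- Labeled graphs are equal when they have the same edge set; no isomorphism
-- is involved.
infix 4 _≈ᴳ_
_≈ᴳ_ : Graph n → Graph n → Set
G ≈ᴳ H = ∀ u v → edge G u v ≡ edge H u v

neighbours : Graph n → Fin n → Subset n
neighbours G v = tabulate (edge G v)

degree : Graph n → Fin n → ℕ
degree G v = ∣ neighbours G v ∣

_Realizes_ : Graph n → (Fin n → ℕ) → Set
G Realizes d = ∀ v → degree G v ≡ d v

-- Each undirected edge is listed once, as the pair (u , v) with u < v.
edgeList : Graph n → List (Fin n × Fin n)
edgeList {n} G =
  filter (λ (u , v) → (u <? v) ×-dec T? (edge G u v))
         (cartesianProduct (allFin n) (allFin n))

∣E∣ : Graph n → ℕ
∣E∣ G = length (edgeList G)

-- Unordered pairs of vertices: (u , v) and (v , u) are the same edge.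
infix 4 _≈ᴱ_ _≉ᴱ_
_≈ᴱ_ : Fin n × Fin n → Fin n × Fin n → Set
(u , v) ≈ᴱ (x , y) = (u ≡ x × v ≡ y) ⊎ (u ≡ y × v ≡ x)

_≉ᴱ_ : Fin n × Fin n → Fin n × Fin n → Set
e ≉ᴱ f = ¬ (e ≈ᴱ f)

edgeSetoid : ℕ → Setoid 0ℓ 0ℓ
edgeSetoid n = record
  { Carrier       = Fin n × Fin n
  ; _≈_           = _≈ᴱ_
  ; isEquivalence = record
    { refl  = inj₁ (refl , refl)
    ; sym   = λ where
        (inj₁ (p , q)) → inj₁ (sym p , sym q)
        (inj₂ (p , q)) → inj₂ (sym q , sym p)
    ; trans = λ where
        (inj₁ (p , q)) (inj₁ (r , s)) → inj₁ (trans p r , trans q s)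
        (inj₁ (p , q)) (inj₂ (r , s)) → inj₂ (trans p r , trans q s)
        (inj₂ (p , q)) (inj₁ (r , s)) → inj₂ (trans p s , trans q r)
        (inj₂ (p , q)) (inj₂ (r , s)) → inj₁ (trans p s , trans q r)
    }
  }

record Swap (G G′ : Graph n) : Set where
  field
    a b c d  : Fin n
    distinct : Unique (a ∷ b ∷ c ∷ d ∷ [])
    ac∈G     : Adj G a c
    bd∈G     : Adj G b d
    bc∉G     : ¬ Adj G b c
    ad∉G     : ¬ Adj G a d
    result   : ∀ u v → Adj G′ u v ⇔
                 ( (Adj G u v × (u , v) ≉ᴱ (a , c) × (u , v) ≉ᴱ (b , d))
                 ⊎ (u , v) ≈ᴱ (b , c)
                 ⊎ (u , v) ≈ᴱ (a , d))

data SwapSequence {n : ℕ} : Graph n → Graph n → ℕ → Set where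
  done : ∀ {G H} → G ≈ᴳ H → SwapSequence G H zero
  step : ∀ {G G′ H k} → Swap G G′ → SwapSequence G′ H k → SwapSequence G H (suc k)

-- Minimality determines m uniquely, so this relation is the graph of the
-- partial function dist_u (undefined if no swap sequence exists).
IsDist : Graph n → Graph n → ℕ → Set
IsDist G₁ G₂ m =
  SwapSequence G₁ G₂ m × (∀ k → SwapSequence G₁ G₂ k → m ≤ k)

_△_ : Graph n → Graph n → Graph n
G₁ △ G₂ = record
  { edge        = λ u v → edge G₁ u v xor edge G₂ u v
  ; edge-sym    = λ u v → cong₂ _xor_ (edge-sym G₁ u v) (edge-sym G₂ u v)
  ; edge-irrefl = λ v → cong₂ _xor_ (edge-irrefl G₁ v) (edge-irrefl G₂ v)
  }

-- The division is exact for two realizations of one degree sequence: they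
-- have equally many edges, so ∣E(G₁) △ E(G₂)∣ = 2 ∣E(G₁) ∖ E(G₂)∣.
H′ : Graph n → Graph n → ℕ
H′ G₁ G₂ = ∣E∣ (G₁ △ G₂) / 2

data Colour : Set where
  red blue : Colour

record RedBlueGraph (n : ℕ) : Set where
  field
    graph      : Graph n
    colour     : ∀ u v → Adj graph u v → Colour
    colour-sym : ∀ u v (e : Adj graph u v) (e′ : Adj graph v u) →
                 colour u v e ≡ colour v u e′

open RedBlueGraph public

redBlue : Graph n → Graph n → RedBlueGraph n
redBlue G₁ G₂ = record
  { graph      = G₁ △ G₂
  ; colour     = λ u v _ → if edge G₁ u v then red else blue
  ; colour-sym = λ u v _ _ → cong (if_then red else blue) (edge-sym G₁ u v)
  }

module _ {n : ℕ} (R : RedBlueGraph n) where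

  open SetoidMembership (edgeSetoid n) using (_∈_)
  open SetoidDisjoint (edgeSetoid n) using (Disjoint)
  open SetoidUnique (edgeSetoid n) using () renaming (Unique to UniqueEdges)

  data Walk : Fin n → Fin n → Set where
    nil  : ∀ {u} → Walk u u
    cons : ∀ {u v} w → Adj (graph R) u w → Walk w v → Walk u v

  walkEdges : ∀ {u v} → Walk u v → List (Fin n × Fin n)
  walkEdges nil              = []
  walkEdges {u} (cons w _ p) = (u , w) ∷ walkEdges p

  walkColours : ∀ {u v} → Walk u v → List Colour
  walkColours nil              = []
  walkColours {u} (cons w e p) = colour R u w e ∷ walkColours p

  -- Repeating the first colour at the end compares the last edge with the
  -- first one as well.
  CyclicallyAlternating : List Colour → Set
  CyclicallyAlternating []       = ⊤
  CyclicallyAlternating (c ∷ cs) = Linked _≢_ (c ∷ cs ++ [ c ])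

  -- The trivial closed walk must be excluded: otherwise empty circuits
  -- could be added to a decomposition without bound.
  record AlternatingCircuit : Set where
    field
      start       : Fin n
      walk        : Walk start start
      nonEmpty    : walkEdges walk ≢ []
      trail       : UniqueEdges (walkEdges walk)
      alternating : CyclicallyAlternating (walkColours walk)

  circuitEdges : AlternatingCircuit → List (Fin n × Fin n)
  circuitEdges C = walkEdges (AlternatingCircuit.walk C)

  record Decomposition : Set where
    field
      circuits : List AlternatingCircuit
      disjoint : AllPairs (λ C D → Disjoint (circuitEdges C) (circuitEdges D)) circuits
      covering : ∀ u v → Adj (graph R) u v →
                 Any (λ C → (u , v) ∈ circuitEdges C) circuits

  size : Decomposition → ℕ
  size D = length (Decomposition.circuits D)

  -- Maximality determines m uniquely. If some vertex has unequally many red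
  -- and blue edges, there is no decomposition and hence no value.
  IsMaxC : ℕ → Set
  IsMaxC m = (∃[ D ] size D ≡ m) × (∀ D → size D ≤ m)

{-# OPTIONS --safe #-}
module Submission where

-- An alternating circuit is a closed walk in the space of states (colour of
-- the next edge, vertex).  Consider all families D of such circuits in which
-- the surplus of red over blue edges at uv is G₁ uv - G₂ uv; parallel red and
-- blue edges are allowed.  Cancelling a parallel pair removes two edges and
-- at most one circuit, so |D| - 2 (number of circuits) does not increase.
--
-- A swap sequence of length k is such a family of k circuits with four edges,
-- and cancelling turns it into a decomposition into at least |E| / 2 - k
-- circuits.  Conversely, every family with m circuits yields a sequence of at
-- most |D| / 2 - m swaps: a circuit either splits or has a vertex u₀ that it
-- visits once.  Then the chord from u₀ to the third vertex after it either
-- admits a swap in G₁ or G₂ that replaces three edges by the chord, or lies in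
-- another circuit, which can trade the chord for these three edges.

open import Defs
import Algebra.Properties.CommutativeMonoid.Sum as CommutativeMonoidSum
open import Data.Bool using (Bool; true; false; T; T?; _xor_; if_then_else_)
open import Data.Bool.Properties using () renaming (_≟_ to _≟ᵇ_)
open import Data.Empty using (⊥-elim)
open import Data.Fin using (Fin; zero; suc)
import Data.Fin as Fin
open import Data.Fin.Properties using (_≟_; any?; all?)
import Data.Fin.Properties as Finₚ
open import Data.Fin.Subset using (∣_∣)
import Data.Integer as ℤ
import Data.Integer.Properties as ℤₚ
open import Data.List using (List; []; _∷_; [_]; _++_; length; concat; map; allFin; cartesianProduct)
open import Data.List.Properties using (length-++; length-map)
import Data.List.Membership.Propositional as Membership
import Data.List.Membership.Propositional.Properties as Membershipₚ
import Data.List.Membership.Setoid as SetoidMembership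
import Data.List.Membership.Setoid.Properties as SetoidMembershipₚ
import Data.List.Relation.Binary.Disjoint.Setoid as SetoidDisjoint
open import Data.List.Relation.Unary.All as All using (All; []; _∷_)
import Data.List.Relation.Unary.All.Properties as Allₚ
open import Data.List.Relation.Unary.AllPairs using (AllPairs; []; _∷_; allPairs?)
import Data.List.Relation.Unary.AllPairs.Properties as AllPairsₚ
open import Data.List.Relation.Unary.Any as Any using (Any; here; there)
import Data.List.Relation.Unary.Any.Properties as Anyₚ
open import Data.List.Relation.Unary.Linked using (Linked; []; [-]; _∷_)
open import Data.List.Relation.Unary.Unique.Propositional using (Unique)
import Data.List.Relation.Unary.Unique.Propositional.Properties as Uniqueₚ
import Data.List.Relation.Unary.Unique.Setoid as SetoidUnique
import Data.List.Relation.Unary.Unique.Setoid.Properties as SetoidUniqueₚ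
open import Data.Nat using (ℕ; zero; suc; _+_; _*_; _∸_; _/_; _≤_; _<_; _≤?_; z≤n; s≤s)
open import Data.Nat.DivMod using (m*n/n≡m)
open import Data.Nat.Induction using (<-rec)
open import Data.Nat.Properties hiding (_≟_)
open import Data.Nat.Solver using (module +-*-Solver)
open import Data.Product using (Σ; ∃; ∃₂; _×_; _,_; proj₁; proj₂)
open import Data.Sum using (_⊎_; inj₁; inj₂)
open import Data.Unit using (tt)
open import Data.Vec using (tabulate)
open import Function using (_∘_)
open import Function.Bundles using (_⇔_; mk⇔; Equivalence)
open import Relation.Binary.Definitions using (tri<; tri≈; tri>)
open import Relation.Binary.PropositionalEquality hiding ([_])
open import Relation.Nullary using (¬_; Dec; yes; no; contradiction)
open import Relation.Nullary.Decidable using (_×-dec_; _⊎-dec_; does; map′; does-⇔; dec-false; ¬?)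

open +-*-Solver using (solve; _:+_; _:*_; _:=_; con)
open CommutativeMonoidSum +-0-commutativeMonoid using (sum; ∑-distrib-+; sum-cong-≗; sum-replicate-zero)

private
  variable
    n : ℕ

-- The intermediate graphs of a swap sequence may use edges outside both G₁ and G₂, so the circuits
-- of its swaps overlap. Disjointness is lost along a sequence, but the signed surplus is additive.
-- The price is that an edge of a circuit need not tell which graph contains it; it does so only in
-- a reduced family, one without parallel pairs. A base visited once ensures that the chord, in the
-- colour of the first edge, is not in the same circuit. If the chord must occur in that colour,
-- another circuit has it. That trade preserves the numbers of edges and of circuits, but shortens
-- the circuit at hand, so the induction is lexicographic: total number of edges, then length of the
-- first circuit. Multisets of coloured edges are compared by evaluating all symmetric weights on
-- them, so that every cutting and pasting becomes a linear identity. Both values come from one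
-- object. A shortest sequence, of length k, reduces to m circuits with |E| ≤ 2 (k + m), while
-- minimality of k gives 2 (k + c) ≤ |E| for every decomposition into c circuits.

𝟙 : ∀ {P : Set} → Dec P → ℕ
𝟙 d = if does d then 1 else 0

𝟙-yes : ∀ {P : Set} (d : Dec P) → P → 𝟙 d ≡ 1
𝟙-yes (yes _) _ = refl
𝟙-yes (no ¬p) p = contradiction p ¬p

𝟙-no : ∀ {P : Set} (d : Dec P) → ¬ P → 𝟙 d ≡ 0
𝟙-no (yes p) ¬p = contradiction p ¬p
𝟙-no (no _)  _  = refl

𝟙-cong : ∀ {P Q : Set} (d : Dec P) (e : Dec Q) → (P → Q) → (Q → P) → 𝟙 d ≡ 𝟙 e
𝟙-cong (yes p) e f _ = sym (𝟙-yes e (f p))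
𝟙-cong (no ¬p) e _ g = sym (𝟙-no e (¬p ∘ g))

𝟙-true : ∀ {P : Set} (d : Dec P) → 1 ≤ 𝟙 d → P
𝟙-true (yes p) _ = p

≈ᴱ-swap : ∀ {u v x y : Fin n} → (u , v) ≈ᴱ (x , y) → (u , v) ≈ᴱ (y , x)
≈ᴱ-swap (inj₁ p) = inj₂ p
≈ᴱ-swap (inj₂ p) = inj₁ p

≈ᴱ-sym : ∀ {u v x y : Fin n} → (u , v) ≈ᴱ (x , y) → (x , y) ≈ᴱ (u , v)
≈ᴱ-sym (inj₁ (refl , refl)) = inj₁ (refl , refl)
≈ᴱ-sym (inj₂ (refl , refl)) = inj₂ (refl , refl)

≈ᴱ-trans : ∀ {e f g : Fin n × Fin n} → e ≈ᴱ f → f ≈ᴱ g → e ≈ᴱ g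
≈ᴱ-trans (inj₁ (refl , refl)) q = q
≈ᴱ-trans (inj₂ (refl , refl)) (inj₁ (refl , refl)) = inj₂ (refl , refl)
≈ᴱ-trans (inj₂ (refl , refl)) (inj₂ (refl , refl)) = inj₁ (refl , refl)

infix 4 _≈ᴱ?_
abstract
  _≈ᴱ?_ : (e f : Fin n × Fin n) → Dec (e ≈ᴱ f)
  (u , v) ≈ᴱ? (x , y) = ((u ≟ x) ×-dec (v ≟ y)) ⊎-dec ((u ≟ y) ×-dec (v ≟ x))

-- Alternating walks and their weights

data Opp : Colour → Colour → Set where
  rb : Opp red blue
  br : Opp blue red

private
  variable
    κ κ̄ κ₁ ι ῑ : Colour

opp-sym : Opp κ ι → Opp ι κ
opp-sym rb = br
opp-sym br = rb

opp-unique : Opp κ ι → Opp κ ῑ → ι ≡ ῑ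
opp-unique rb rb = refl
opp-unique br br = refl

opp-cases : Opp κ κ̄ → ∀ κ₁ → κ₁ ≡ κ ⊎ κ₁ ≡ κ̄
opp-cases rb red  = inj₁ refl
opp-cases rb blue = inj₂ refl
opp-cases br red  = inj₂ refl
opp-cases br blue = inj₁ refl

-- A state (κ , u) is a vertex together with the colour of the edge by which
-- an alternating walk leaves it.  So a closed path of states is a closed walk
-- that also alternates at its base point.
State : ℕ → Set
State n = Colour × Fin n

data Path {n : ℕ} : State n → State n → Set where
  nil  : ∀ {s} → Path s s
  cons : ∀ {κ κ̄ u w t} → Opp κ κ̄ → u ≢ w → Path (κ̄ , w) t → Path (κ , u) t

private
  variable
    r s t : State n
    u v w x y : Fin n

infixr 5 _⟫_
_⟫_ : Path r s → Path s t → Path r t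
nil        ⟫ q = q
cons o d p ⟫ q = cons o d (p ⟫ q)

edge⟨_,_⟩ : Opp κ κ̄ → u ≢ w → Path (κ , u) (κ̄ , w)
edge⟨ o , d ⟩ = cons o d nil

-- A state names the colour still due, so a nonempty path that ends in `(ι , v)` arrives by an edge
-- of colour `ῑ`. The reversed path leaves `v` by that colour and returns to `u` by colour `κ`,
-- after which `κ̄` is due.
rev : Opp κ κ̄ → Opp ι ῑ → Path (κ , u) (ι , v) → Path (ῑ , v) (κ̄ , u)
rev {u = u} o o′ nil with refl ← opp-unique o o′ = nil
rev o o′ (cons o₁ u≢w p) = rev (opp-sym o₁) o′ p ⟫ edge⟨ o , u≢w ∘ sym ⟩

-- Two walks have the same multiset of coloured undirected edges exactly when every weight has the
-- same sum on both. Quantifying over weights replaces permutations of edge lists, and symmetry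
-- makes reversal harmless.
record Weight (n : ℕ) : Set where
  field
    weight     : Colour → Fin n → Fin n → ℕ
    weight-sym : ∀ κ u v → weight κ u v ≡ weight κ v u

open Weight

∥_∥ : {s t : State n} → Path s t → Weight n → ℕ
∥ nil ∥ f = 0
∥ cons {κ = κ} {u = u} {w = w} _ _ p ∥ f = weight f κ u w + ∥ p ∥ f

∥⟫∥ : (p : Path r s) (q : Path s t) → ∀ f → ∥ p ⟫ q ∥ f ≡ ∥ p ∥ f + ∥ q ∥ f
∥⟫∥ nil q f = refl
∥⟫∥ (cons o d p) q f = trans (cong (weight f _ _ _ +_) (∥⟫∥ p q f)) (sym (+-assoc (weight f _ _ _) _ _))

∥rev∥ : (o : Opp κ κ̄) (o′ : Opp ι ῑ) (p : Path (κ , u) (ι , v)) → ∀ f → ∥ rev o o′ p ∥ f ≡ ∥ p ∥ f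
∥rev∥ o o′ nil f with refl ← opp-unique o o′ = refl
∥rev∥ {κ = κ} {u = u} o o′ (cons {w = w} o₁ d p) f = begin
  ∥ rev (opp-sym o₁) o′ p ⟫ edge⟨ o , _ ⟩ ∥ f          ≡⟨ ∥⟫∥ (rev (opp-sym o₁) o′ p) _ f ⟩
  ∥ rev (opp-sym o₁) o′ p ∥ f + (weight f _ w u + 0)   ≡⟨ cong₂ _+_ (∥rev∥ (opp-sym o₁) o′ p f) (trans (+-identityʳ _) (weight-sym f κ w u)) ⟩
  ∥ p ∥ f + weight f κ u w                             ≡⟨ +-comm (∥ p ∥ f) _ ⟩
  weight f κ u w + ∥ p ∥ f                             ∎
  where open ≡-Reasoning

-- Keeping the first edge apart from `rest` excludes the empty closed path.
record Circuit (n : ℕ) : Set where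
  constructor circuit
  field
    {col col̄}   : Colour
    {base next} : Fin n
    opp         : Opp col col̄
    distinct    : base ≢ next
    rest        : Path (col̄ , next) (col , base)

  closed : Path (col , base) (col , base)
  closed = cons opp distinct rest

open Circuit using (closed)

∥_∥ᶜ : Circuit n → Weight n → ℕ
∥ C ∥ᶜ = ∥ closed C ∥

∥_∥* : List (Circuit n) → Weight n → ℕ
∥ [] ∥* f    = 0
∥ C ∷ D ∥* f = ∥ C ∥ᶜ f + ∥ D ∥* f

-- An empty closed path yields no circuit. When both edges of a parallel pair lie in one circuit,
-- this is the only way to lose a circuit.
close : {s : State n} → Path s s → List (Circuit n)
close nil          = []
close (cons o d p) = [ circuit o d p ]

∥close∥ : (p : Path s s) → ∀ f → ∥ close p ∥* f ≡ ∥ p ∥ f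
∥close∥ nil f = refl
∥close∥ (cons o d p) f = +-identityʳ _

∥++∥ : (D E : List (Circuit n)) → ∀ f → ∥ D ++ E ∥* f ≡ ∥ D ∥* f + ∥ E ∥* f
∥++∥ []      E f = refl
∥++∥ (C ∷ D) E f = trans (cong (∥ C ∥ᶜ f +_) (∥++∥ D E f)) (sym (+-assoc (∥ C ∥ᶜ f) _ _))

matching : Colour → Colour → ℕ → ℕ
matching red  red  k = k
matching red  blue k = 0
matching blue red  k = 0
matching blue blue k = k

matching-same : ∀ κ {k} → matching κ κ k ≡ k
matching-same red  = refl
matching-same blue = refl

matching-opp : Opp κ κ̄ → ∀ {k} → matching κ κ̄ k ≡ 0
matching-opp rb = refl
matching-opp br = refl

matching-positive : ∀ κ ι {k} → 1 ≤ matching κ ι k → κ ≡ ι × 1 ≤ k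
matching-positive red  red  le = refl , le
matching-positive blue blue le = refl , le

-- The indicator of one coloured edge: `∥ D ∥* (δ κ u v)` is the multiplicity of `uv` in colour `κ`,
-- just as `∥ D ∥* one` is the number of edges.
δ : Colour → Fin n → Fin n → Weight n
δ κ u v = record
  { weight     = λ ι x y → matching κ ι (𝟙 ((u , v) ≈ᴱ? (x , y)))
  ; weight-sym = λ ι x y → cong (matching κ ι)
      (𝟙-cong ((u , v) ≈ᴱ? (x , y)) ((u , v) ≈ᴱ? (y , x)) ≈ᴱ-swap ≈ᴱ-swap)
  }

one : Weight n
one = record { weight = λ _ _ _ → 1 ; weight-sym = λ _ _ _ → refl }

∥∥-δ-resp : ∀ κ (u v x y : Fin n) → (u , v) ≈ᴱ (x , y) → (p : Path s t) →
            ∥ p ∥ (δ κ u v) ≡ ∥ p ∥ (δ κ x y)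
∥∥-δ-resp κ u v x y e≈f nil = refl
∥∥-δ-resp κ u v x y e≈f (cons {κ = ι} o _ p) =
  cong₂ _+_ (cong (matching κ ι) (𝟙-cong (_ ≈ᴱ? _) (_ ≈ᴱ? _) (≈ᴱ-trans (≈ᴱ-sym e≈f)) (≈ᴱ-trans e≈f)))
            (∥∥-δ-resp κ u v x y e≈f p)

∥∥*-δ-resp : ∀ κ (u v x y : Fin n) → (u , v) ≈ᴱ (x , y) → (D : List (Circuit n)) →
             ∥ D ∥* (δ κ u v) ≡ ∥ D ∥* (δ κ x y)
∥∥*-δ-resp κ u v x y e≈f []      = refl
∥∥*-δ-resp κ u v x y e≈f (C ∷ D) = cong₂ _+_ (∥∥-δ-resp κ u v x y e≈f (closed C)) (∥∥*-δ-resp κ u v x y e≈f D)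

-- Cutting walks and opening circuits at a given edge

record Cut {n} {s t : State n} (p : Path s t) (κ : Colour) (x y : Fin n) : Set where
  field
    {col̄}    : Colour
    before   : Path s (κ , x)
    opp      : Opp κ col̄
    distinct : x ≢ y
    after    : Path (col̄ , y) t
    sums     : ∀ f → ∥ p ∥ f ≡ ∥ before ∥ f + (weight f κ x y + ∥ after ∥ f)

cut-here : (o : Opp κ κ̄) (u≢w : u ≢ w) (p : Path (κ̄ , w) t) → Cut (cons o u≢w p) κ u w
cut-here o u≢w p = record { before = nil ; opp = o ; distinct = u≢w ; after = p ; sums = λ _ → refl }

cut-there : (o : Opp κ κ̄) (u≢w : u ≢ w) {p : Path (κ̄ , w) t} → Cut p κ₁ x y → Cut (cons o u≢w p) κ₁ x y
cut-there o u≢w k = record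
  { before = cons o u≢w before ; opp = opp ; distinct = distinct ; after = after
  ; sums = λ f → trans (cong (weight f _ _ _ +_) (sums f)) (sym (+-assoc (weight f _ _ _) _ _)) }
  where open Cut k

1≤+ : ∀ a {b} → 1 ≤ a + b → 1 ≤ a ⊎ 1 ≤ b
1≤+ zero    le = inj₂ le
1≤+ (suc a) le = inj₁ (s≤s z≤n)

cut-at-edge : ∀ κ u v (p : Path s t) → 1 ≤ ∥ p ∥ (δ κ u v) → ∃₂ λ x y → (u , v) ≈ᴱ (x , y) × Cut p κ x y
cut-at-edge κ u v (cons {κ = ι} {u = x} {w = y} o x≢y p) le
  with 1≤+ (weight (δ κ u v) ι x y) le
... | inj₁ in-first with refl , in-first′ ← matching-positive κ ι in-first =
      x , y , 𝟙-true (_ ≈ᴱ? _) in-first′ , cut-here o x≢y p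
... | inj₂ in-rest with x′ , y′ , e≈ , k ← cut-at-edge κ u v p in-rest = x′ , y′ , e≈ , cut-there o x≢y k

-- Only vertices from which an edge leaves are tested. The final vertex is exempt because the rest
-- of a circuit always ends at its base.
data Avoids (x : Fin n) {t : State n} : ∀ {s} → Path s t → Set where
  nil  : Avoids x nil
  cons : ∀ {κ κ̄ u w} {o : Opp κ κ̄} {u≢w : u ≢ w} {p : Path (κ̄ , w) t} →
         u ≢ x → Avoids x p → Avoids x (cons o u≢w p)

avoids-⟫ : {p : Path r s} {q : Path s t} → Avoids x p → Avoids x q → Avoids x (p ⟫ q)
avoids-⟫ nil        av = av
avoids-⟫ (cons d a) av = cons d (avoids-⟫ a av)

visit? : ∀ x (p : Path s t) → Avoids x p ⊎ ∃₂ λ κ y → Cut p κ x y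
visit? x nil = inj₁ nil
visit? x (cons {κ = κ} {u = u} {w = w} o u≢w p) with u ≟ x | visit? x p
... | yes refl | _                  = inj₂ (κ , w , cut-here o u≢w p)
... | no u≢x   | inj₁ av            = inj₁ (cons u≢x av)
... | no u≢x   | inj₂ (κ′ , y , k)  = inj₂ (κ′ , y , cut-there o u≢w k)

record Opened (n : ℕ) (κ κ̄ : Colour) (u v : Fin n) (W : Weight n → ℕ) : Set where
  field
    distinct : u ≢ v
    path     : Path (κ̄ , v) (κ , u)
    sums     : ∀ f → W f ≡ weight f κ u v + ∥ path ∥ f

-- Rotation brings the edge to the front; if the circuit traverses it from `v` to `u`, the remaining
-- path is reversed.
open-circuit : ∀ u v → Opp κ κ̄ → (C : Circuit n) → 1 ≤ ∥ C ∥ᶜ (δ κ u v) → Opened n κ κ̄ u v ∥ C ∥ᶜ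
open-circuit {κ = κ} u v o C le with cut-at-edge κ u v (closed C) le
... | x , y , e≈ , k with refl ← opp-unique o (Cut.opp k) = go e≈
  where
  open Cut k
  q = after ⟫ before
  q-sums : ∀ f → ∥ C ∥ᶜ f ≡ weight f κ x y + ∥ q ∥ f
  q-sums f = begin
    ∥ C ∥ᶜ f                                            ≡⟨ sums f ⟩
    ∥ before ∥ f + (weight f κ x y + ∥ after ∥ f)       ≡⟨ solve 3 (λ a b c → a :+ (b :+ c) := b :+ (c :+ a)) refl (∥ before ∥ f) (weight f κ x y) (∥ after ∥ f) ⟩
    weight f κ x y + (∥ after ∥ f + ∥ before ∥ f)       ≡⟨ cong (weight f κ x y +_) (sym (∥⟫∥ after before f)) ⟩
    weight f κ x y + ∥ q ∥ f                            ∎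
    where open ≡-Reasoning
  go : ∀ {u v} → (u , v) ≈ᴱ (x , y) → Opened _ κ _ u v ∥ C ∥ᶜ
  go (inj₁ (refl , refl)) = record { distinct = distinct ; path = q ; sums = q-sums }
  go (inj₂ (refl , refl)) = record
    { distinct = distinct ∘ sym
    ; path = rev (opp-sym o) o q
    ; sums = λ f → trans (q-sums f) (cong₂ _+_ (weight-sym f κ x y) (sym (∥rev∥ (opp-sym o) o q f))) }

record OpenedIn (κ κ̄ : Colour) (u v : Fin n) (D : List (Circuit n)) : Set where
  field
    distinct : u ≢ v
    path     : Path (κ̄ , v) (κ , u)
    others   : List (Circuit n)
    sums     : ∀ f → ∥ D ∥* f ≡ weight f κ u v + (∥ path ∥ f + ∥ others ∥* f)
    count    : length D ≡ suc (length others)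

open-at : ∀ u v → Opp κ κ̄ → (D : List (Circuit n)) → 1 ≤ ∥ D ∥* (δ κ u v) → OpenedIn κ κ̄ u v D
open-at {κ = κ} u v o (C ∷ D) le with 1≤+ (∥ C ∥ᶜ (δ κ u v)) le
... | inj₁ in-first = record
  { distinct = distinct ; path = path ; others = D
  ; sums = λ f → trans (cong (_+ ∥ D ∥* f) (sums f)) (+-assoc (weight f _ _ _) _ _)
  ; count = refl }
  where open Opened (open-circuit u v o C in-first)
... | inj₂ in-rest = record
  { distinct = distinct ; path = path ; others = C ∷ others
  ; sums = λ f → trans (cong (∥ C ∥ᶜ f +_) (sums f))
      (solve 4 (λ a b c d → a :+ (b :+ (c :+ d)) := b :+ (c :+ (a :+ d))) refl (∥ C ∥ᶜ f) (weight f κ u v) (∥ path ∥ f) (∥ others ∥* f))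
  ; count = cong suc count }
  where open OpenedIn (open-at u v o D in-rest)

-- Splitting circuits and cancelling parallel edges

-- The circuit in `simple` has the same edges as the original one but may have another base and
-- another first colour, which is why it is tied to the original by weights only.
data Analysis {n : ℕ} (W : Weight n → ℕ) : Set where
  splits : (C₁ C₂ : Circuit n) → (∀ f → W f ≡ ∥ C₁ ∥ᶜ f + ∥ C₂ ∥ᶜ f) → Analysis W
  simple : (C : Circuit n) → Avoids (Circuit.base C) (Circuit.rest C) → (∀ f → W f ≡ ∥ C ∥ᶜ f) → Analysis W

analysis-resp : {W W′ : Weight n → ℕ} → (∀ f → W f ≡ W′ f) → Analysis W′ → Analysis W
analysis-resp W≡W′ (splits C₁ C₂ eq) = splits C₁ C₂ λ f → trans (W≡W′ f) (eq f)
analysis-resp W≡W′ (simple C av eq)  = simple C av λ f → trans (W≡W′ f) (eq f)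

-- The circuit is e p q, where e : u → w starts the odd closed walk e p at u.
-- If w occurs inside p, then either it cuts off an alternating circuit or an
-- odd closed walk shorter than e p.  If w occurs in q, then the circuit splits
-- at w, if necessary after reversing e p, which changes the parity of w.
analyse-odd : ∀ m (o : Opp κ κ̄) (u≢w : u ≢ w) (p : Path (κ̄ , w) (κ̄ , u)) (q : Path (κ̄ , u) (κ , u)) →
              ∥ p ∥ one ≤ m → Analysis (λ f → weight f κ u w + (∥ p ∥ f + ∥ q ∥ f))
analyse-odd m o u≢w nil q le = contradiction refl u≢w
analyse-odd {κ = κ} {u = u} {w = w} (suc m) o u≢w p@(cons {κ = κ̄} {w = y} o′ w≢y p′) q (s≤s le)
  with refl ← opp-unique o′ (opp-sym o) with visit? w p′
... | inj₂ (κ₁ , z , k) with opp-cases o κ₁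
...   | inj₂ refl = splits (circuit o′ w≢y before) (circuit opp distinct (after ⟫ q ⟫ edge⟨ o , u≢w ⟩)) eq
  where
  open Cut k
  eq : ∀ f → weight f κ u w + ((weight f κ̄ w y + ∥ p′ ∥ f) + ∥ q ∥ f) ≡
             (weight f κ̄ w y + ∥ before ∥ f) + (weight f κ̄ w z + ∥ after ⟫ q ⟫ edge⟨ o , u≢w ⟩ ∥ f)
  eq f rewrite sums f | ∥⟫∥ after (q ⟫ edge⟨ o , u≢w ⟩) f | ∥⟫∥ q (edge⟨ o , u≢w ⟩) f =
    solve 6 (λ e b k z a q → e :+ ((b :+ (k :+ (z :+ a))) :+ q) := (b :+ k) :+ (z :+ (a :+ (q :+ (e :+ con 0)))))
      refl (weight f κ u w) (weight f κ̄ w y) (∥ before ∥ f) (weight f κ̄ w z) (∥ after ∥ f) (∥ q ∥ f)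
...   | inj₁ refl = analysis-resp eq
        (analyse-odd m o′ w≢y before (cons opp distinct (after ⟫ q ⟫ edge⟨ o , u≢w ⟩)) before≤m)
  where
  open Cut k
  eq : ∀ f → weight f κ u w + ((weight f κ̄ w y + ∥ p′ ∥ f) + ∥ q ∥ f) ≡
             weight f κ̄ w y + (∥ before ∥ f + (weight f κ w z + ∥ after ⟫ q ⟫ edge⟨ o , u≢w ⟩ ∥ f))
  eq f rewrite sums f | ∥⟫∥ after (q ⟫ edge⟨ o , u≢w ⟩) f | ∥⟫∥ q (edge⟨ o , u≢w ⟩) f =
    solve 6 (λ e b k z a q → e :+ ((b :+ (k :+ (z :+ a))) :+ q) := b :+ (k :+ (z :+ (a :+ (q :+ (e :+ con 0))))))
      refl (weight f κ u w) (weight f κ̄ w y) (∥ before ∥ f) (weight f κ w z) (∥ after ∥ f) (∥ q ∥ f)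
  before≤m : ∥ before ∥ one ≤ m
  before≤m = ≤-trans (m≤m+n _ _) (≤-trans (≤-reflexive (sym (sums one))) le)
analyse-odd {κ = κ} {u = u} {w = w} (suc m) o u≢w p@(cons {κ = κ̄} {w = y} o′ w≢y p′) q (s≤s le)
  | inj₁ av with visit? w q
... | inj₁ av′ = simple (circuit o′ w≢y (p′ ⟫ q ⟫ edge⟨ o , u≢w ⟩)) (avoids-⟫ av (avoids-⟫ av′ (cons u≢w nil))) eq
  where
  eq : ∀ f → weight f κ u w + ((weight f κ̄ w y + ∥ p′ ∥ f) + ∥ q ∥ f) ≡
             weight f κ̄ w y + ∥ p′ ⟫ q ⟫ edge⟨ o , u≢w ⟩ ∥ f
  eq f rewrite ∥⟫∥ p′ (q ⟫ edge⟨ o , u≢w ⟩) f | ∥⟫∥ q (edge⟨ o , u≢w ⟩) f =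
    solve 4 (λ e b p q → e :+ ((b :+ p) :+ q) := b :+ (p :+ (q :+ (e :+ con 0))))
      refl (weight f κ u w) (weight f κ̄ w y) (∥ p′ ∥ f) (∥ q ∥ f)
... | inj₂ (κ₁ , z , k) with opp-cases o κ₁
...   | inj₂ refl = splits (circuit o′ w≢y (p′ ⟫ before)) (circuit opp distinct (after ⟫ edge⟨ o , u≢w ⟩)) eq
  where
  open Cut k
  eq : ∀ f → weight f κ u w + ((weight f κ̄ w y + ∥ p′ ∥ f) + ∥ q ∥ f) ≡
             (weight f κ̄ w y + ∥ p′ ⟫ before ∥ f) + (weight f κ̄ w z + ∥ after ⟫ edge⟨ o , u≢w ⟩ ∥ f)
  eq f rewrite sums f | ∥⟫∥ p′ before f | ∥⟫∥ after (edge⟨ o , u≢w ⟩) f =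
    solve 6 (λ e b p k z a → e :+ ((b :+ p) :+ (k :+ (z :+ a))) := (b :+ (p :+ k)) :+ (z :+ (a :+ (e :+ con 0))))
      refl (weight f κ u w) (weight f κ̄ w y) (∥ p′ ∥ f) (∥ before ∥ f) (weight f κ̄ w z) (∥ after ∥ f)
...   | inj₁ refl = splits (circuit o (u≢w ∘ sym) before) (circuit opp distinct (after ⟫ p⁻¹)) eq
  where
  open Cut k
  p⁻¹ = rev (opp-sym o) (opp-sym o) p
  eq : ∀ f → weight f κ u w + (∥ p ∥ f + ∥ q ∥ f) ≡
             (weight f κ w u + ∥ before ∥ f) + (weight f κ w z + ∥ after ⟫ p⁻¹ ∥ f)
  eq f rewrite sums f | ∥⟫∥ after p⁻¹ f | ∥rev∥ (opp-sym o) (opp-sym o) p f | weight-sym f κ w u =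
    solve 5 (λ e p k z a → e :+ (p :+ (k :+ (z :+ a))) := (e :+ k) :+ (z :+ (a :+ p)))
      refl (weight f κ u w) (∥ p ∥ f) (∥ before ∥ f) (weight f κ w z) (∥ after ∥ f)

-- A return to the base with the first colour due closes an alternating circuit and splits the walk.
-- A return with the other colour due closes an odd walk, which `analyse-odd` takes over.
analyse : (C : Circuit n) → Analysis ∥ C ∥ᶜ
analyse C@(circuit {κ} {κ̄} {u} {w} o u≢w rest) with visit? u rest
... | inj₁ av = simple C av λ _ → refl
... | inj₂ (κ₁ , y , k) with opp-cases o κ₁
...   | inj₁ refl = splits (circuit o u≢w before) (circuit opp distinct after)
                      λ f → trans (cong (weight f κ u w +_) (sums f)) (sym (+-assoc (weight f κ u w) _ _))
  where open Cut k
...   | inj₂ refl = analysis-resp (λ f → cong (weight f κ u w +_) (sums f))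
                      (analyse-odd (∥ before ∥ one) o u≢w before (cons opp distinct after) ≤-refl)
  where open Cut k

𝔟 : Bool → ℕ
𝔟 b = if b then 1 else 0

𝔟-injective : ∀ a b → 𝔟 a ≡ 𝔟 b → a ≡ b
𝔟-injective false false _ = refl
𝔟-injective true  true  _ = refl

-- The surplus of κ over κ̄ edges at uv is G uv - H uv, stated without subtraction.
record Links {n : ℕ} (κ κ̄ : Colour) (G H : Graph n) (D : List (Circuit n)) : Set where
  constructor linking
  field
    balance : ∀ u v → 𝔟 (edge G u v) + ∥ D ∥* (δ κ̄ u v) ≡ 𝔟 (edge H u v) + ∥ D ∥* (δ κ u v)

open Links

private
  variable
    G H G₁ H₁ : Graph n
    D D′ : List (Circuit n)

links-sym : Links κ κ̄ G H D → Links κ̄ κ H G D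
links-sym links = linking λ u v → sym (balance links u v)

links-resp : (∀ f → ∥ D ∥* f ≡ ∥ D′ ∥* f) → Links κ κ̄ G H D → Links κ κ̄ G H D′
links-resp {G = G} {H = H} eq links = linking λ u v →
  trans (cong (𝔟 (edge G u v) +_) (sym (eq _))) (trans (balance links u v) (cong (𝔟 (edge H u v) +_) (eq _)))

Clash : List (Circuit n) → Fin n → Fin n → Set
Clash D u v = 1 ≤ ∥ D ∥* (δ red u v) × 1 ≤ ∥ D ∥* (δ blue u v)

Reduced : List (Circuit n) → Set
Reduced D = ∀ u v → ¬ Clash D u v

reduced? : (D : List (Circuit n)) → Reduced D ⊎ ∃₂ (Clash D)
reduced? D with any? (λ u → any? λ v → (1 ≤? ∥ D ∥* (δ red u v)) ×-dec (1 ≤? ∥ D ∥* (δ blue u v)))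
... | yes clash = inj₂ clash
... | no ¬clash = inj₁ λ u v k → ¬clash (u , v , k)

record Cancelled {n} (D : List (Circuit n)) (u v : Fin n) : Set where
  field
    remaining : List (Circuit n)
    sums      : ∀ f → ∥ D ∥* f ≡ (weight f red u v + weight f blue u v) + ∥ remaining ∥* f
    count     : length D ≤ suc (length remaining)

-- If the two edges lie in different circuits, what remains of these merges into one. If they lie in
-- one circuit and are traversed in the same direction, one of the two remaining arcs is reversed
-- and both close up together; if in opposite directions, each arc closes up by itself. So at most
-- one circuit disappears.
cancel : (D : List (Circuit n)) → ∀ u v → Clash D u v → Cancelled D u v
cancel D u v (r , b) = go (1≤+ (∥ path ∥ (δ blue u v)) (subst (1 ≤_) blue-count b))
  where
  open OpenedIn (open-at u v rb D r)
  open ≡-Reasoning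
  blue-count : ∥ D ∥* (δ blue u v) ≡ ∥ path ∥ (δ blue u v) + ∥ others ∥* (δ blue u v)
  blue-count = sums (δ blue u v)
  go : 1 ≤ ∥ path ∥ (δ blue u v) ⊎ 1 ≤ ∥ others ∥* (δ blue u v) → Cancelled D u v
  go (inj₂ le) = record
    { remaining = close (path ⟫ K.path) ++ K.others
    ; sums = λ f → begin
        ∥ D ∥* f
          ≡⟨ sums f ⟩
        weight f red u v + (∥ path ∥ f + ∥ others ∥* f)
          ≡⟨ cong (λ z → weight f red u v + (∥ path ∥ f + z)) (K.sums f) ⟩
        weight f red u v + (∥ path ∥ f + (weight f blue v u + (∥ K.path ∥ f + ∥ K.others ∥* f)))
          ≡⟨ cong (λ z → weight f red u v + (∥ path ∥ f + (z + (∥ K.path ∥ f + ∥ K.others ∥* f)))) (weight-sym f blue v u) ⟩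
        weight f red u v + (∥ path ∥ f + (weight f blue u v + (∥ K.path ∥ f + ∥ K.others ∥* f)))
          ≡⟨ solve 5 (λ r p b k o → r :+ (p :+ (b :+ (k :+ o))) := (r :+ b) :+ ((p :+ k) :+ o)) refl
               (weight f red u v) (∥ path ∥ f) (weight f blue u v) (∥ K.path ∥ f) (∥ K.others ∥* f) ⟩
        (weight f red u v + weight f blue u v) + ((∥ path ∥ f + ∥ K.path ∥ f) + ∥ K.others ∥* f)
          ≡⟨ cong (λ z → (weight f red u v + weight f blue u v) + (z + ∥ K.others ∥* f))
               (sym (trans (∥close∥ (path ⟫ K.path) f) (∥⟫∥ path K.path f))) ⟩
        (weight f red u v + weight f blue u v) + (∥ close (path ⟫ K.path) ∥* f + ∥ K.others ∥* f)
          ≡⟨ cong ((weight f red u v + weight f blue u v) +_) (sym (∥++∥ (close (path ⟫ K.path)) K.others f)) ⟩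
        (weight f red u v + weight f blue u v) + ∥ close (path ⟫ K.path) ++ K.others ∥* f ∎
    ; count = subst₂ _≤_ (sym (trans count (cong suc K.count))) (cong suc (sym (nonempty path)))  ≤-refl
    }
    where
    module K = OpenedIn (open-at v u br others (subst (1 ≤_) (∥∥*-δ-resp blue u v v u (inj₂ (refl , refl)) others) le))
    -- The two end states differ in colour, so the path has an edge and `close` does not drop the
    -- merged walk.
    nonempty : (p : Path (blue , v) (red , u)) → length (close (p ⟫ K.path) ++ K.others) ≡ suc (length K.others)
    nonempty (cons _ _ _) = refl
  go (inj₁ le) with cut-at-edge blue u v path le
  ... | x , y , e≈ , k with refl ← opp-unique br (Cut.opp k) = pieces e≈
    where
    module K = Cut k
    assemble : ∀ {s t} (p : Path s s) (q : Path t t) →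
               (∀ f → ∥ D ∥* f ≡ (weight f red u v + weight f blue u v) + ((∥ p ∥ f + ∥ q ∥ f) + ∥ others ∥* f)) →
               Cancelled D u v
    assemble p q eq = record
      { remaining = (close p ++ close q) ++ others
      ; sums = λ f → trans (eq f) (cong ((weight f red u v + weight f blue u v) +_)
          (sym (trans (∥++∥ (close p ++ close q) others f) (cong (_+ ∥ others ∥* f)
            (trans (∥++∥ (close p) (close q) f) (cong₂ _+_ (∥close∥ p f) (∥close∥ q f)))))))
      ; count = ≤-trans (≤-reflexive count) (s≤s (≤-trans (m≤n+m _ _) (≤-reflexive (sym (length-++ (close p ++ close q))))))
      }
    expand : ∀ f {z} → weight f blue x y ≡ z → ∥ D ∥* f ≡
               (weight f red u v + z) + ((∥ K.before ∥ f + ∥ K.after ∥ f) + ∥ others ∥* f)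
    expand f refl = trans (sums f) (trans (cong (λ z → weight f red u v + (z + ∥ others ∥* f)) (K.sums f))
      (solve 5 (λ r b w a o → r :+ ((b :+ (w :+ a)) :+ o) := (r :+ w) :+ ((b :+ a) :+ o)) refl
        (weight f red u v) (∥ K.before ∥ f) (weight f blue x y) (∥ K.after ∥ f) (∥ others ∥* f)))
    pieces : (u , v) ≈ᴱ (x , y) → Cancelled D u v
    -- Only one closed walk remains here; an empty one fills the second slot of `assemble`.
    pieces (inj₁ (refl , refl)) = assemble (K.before ⟫ rev rb rb K.after) (nil {s = red , u}) λ f →
      trans (expand f refl) (cong (λ z → (weight f red u v + weight f blue u v) + (z + ∥ others ∥* f))
        (sym (trans (+-identityʳ (∥ K.before ⟫ rev rb rb K.after ∥ f)) (trans (∥⟫∥ K.before (rev rb rb K.after) f)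
          (cong (∥ K.before ∥ f +_) (∥rev∥ rb rb K.after f))))))
    pieces (inj₂ (refl , refl)) = assemble K.before K.after λ f → expand f {weight f blue u v} (weight-sym f blue v u)

-- Swaps

T-does : ∀ {P : Set} (d : Dec P) → T (does d) → P
T-does (yes p) _ = p

does-T : ∀ {P : Set} (d : Dec P) → P → T (does d)
does-T (yes _) _ = tt
does-T (no ¬p) p = ¬p p

𝔟-true : ∀ {b} → T b → 𝔟 b ≡ 1
𝔟-true {true} _ = refl

𝔟-false : ∀ {b} → ¬ T b → 𝔟 b ≡ 0
𝔟-false {true}  ¬t = ⊥-elim (¬t tt)
𝔟-false {false} _  = refl

𝔟-cong : ∀ {a b} → (T a → T b) → (T b → T a) → 𝔟 a ≡ 𝔟 b
𝔟-cong {true}  f g = sym (𝔟-true (f tt))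
𝔟-cong {false} f g = sym (𝔟-false g)

adj-resp : (G : Graph n) {e f : Fin n × Fin n} → e ≈ᴱ f →
           Adj G (proj₁ f) (proj₂ f) → Adj G (proj₁ e) (proj₂ e)
adj-resp G (inj₁ (refl , refl)) a = a
adj-resp G (inj₂ (refl , refl)) a = subst T (edge-sym G _ _) a

record Swappable (G : Graph n) (a b c d : Fin n) : Set where
  field
    distinct : Unique (a ∷ b ∷ c ∷ d ∷ [])
    ac∈G     : Adj G a c
    bd∈G     : Adj G b d
    bc∉G     : ¬ Adj G b c
    ad∉G     : ¬ Adj G a d

swappable? : (G : Graph n) → ∀ a b c d → Dec (Swappable G a b c d)
swappable? G a b c d =
  map′ (λ (p , q , r , s , t) → record { distinct = p ; ac∈G = q ; bd∈G = r ; bc∉G = s ; ad∉G = t })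
       (λ k → let open Swappable k in distinct , ac∈G , bd∈G , bc∉G , ad∉G)
       (allPairs? (λ x y → ¬? (x ≟ y)) _ ×-dec T? _ ×-dec T? _ ×-dec ¬? (T? _) ×-dec ¬? (T? _))

AfterSwap : Graph n → (a b c d u v : Fin n) → Set
AfterSwap G a b c d u v =
    (Adj G u v × (u , v) ≉ᴱ (a , c) × (u , v) ≉ᴱ (b , d))
  ⊎ (u , v) ≈ᴱ (b , c)
  ⊎ (u , v) ≈ᴱ (a , d)

afterSwap? : (G : Graph n) → ∀ a b c d u v → Dec (AfterSwap G a b c d u v)
afterSwap? G a b c d u v =
  (T? (edge G u v) ×-dec ¬? (_ ≈ᴱ? _) ×-dec ¬? (_ ≈ᴱ? _)) ⊎-dec (_ ≈ᴱ? _) ⊎-dec (_ ≈ᴱ? _)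

afterSwap-sym : (G : Graph n) → ∀ a b c d u v → AfterSwap G a b c d u v → AfterSwap G a b c d v u
afterSwap-sym G a b c d u v (inj₁ (uv∈G , ≉ac , ≉bd)) =
  inj₁ (adj-resp G (inj₂ (refl , refl)) uv∈G , ≉ac ∘ flip , ≉bd ∘ flip)
  where
  flip : ∀ {f} → (v , u) ≈ᴱ f → (u , v) ≈ᴱ f
  flip = ≈ᴱ-trans (inj₂ (refl , refl))
afterSwap-sym G a b c d u v (inj₂ (inj₁ p)) = inj₂ (inj₁ (≈ᴱ-trans (inj₂ (refl , refl)) p))
afterSwap-sym G a b c d u v (inj₂ (inj₂ p)) = inj₂ (inj₂ (≈ᴱ-trans (inj₂ (refl , refl)) p))

swappedGraph : (G : Graph n) → ∀ {a b c d} → Swappable G a b c d → Graph n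
swappedGraph G {a} {b} {c} {d} ok = record
  { edge        = λ u v → does (afterSwap? G a b c d u v)
  ; edge-sym    = λ u v → does-⇔ (mk⇔ (afterSwap-sym G a b c d u v) (afterSwap-sym G a b c d v u))
                                (afterSwap? G a b c d u v) (afterSwap? G a b c d v u)
  ; edge-irrefl = λ v → dec-false (afterSwap? G a b c d v v) (no-loop (Swappable.distinct ok))
  }
  where
  no-loop : ∀ {v} → Unique (a ∷ b ∷ c ∷ d ∷ []) → ¬ AfterSwap G a b c d v v
  no-loop {v} _ (inj₁ (vv∈G , _)) = subst T (edge-irrefl G v) vv∈G
  no-loop (_ ∷ (b≢c ∷ _) ∷ _) (inj₂ (inj₁ (inj₁ (refl , refl)))) = b≢c refl
  no-loop (_ ∷ (b≢c ∷ _) ∷ _) (inj₂ (inj₁ (inj₂ (refl , refl)))) = b≢c refl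
  no-loop ((_ ∷ _ ∷ a≢d ∷ _) ∷ _) (inj₂ (inj₂ (inj₁ (refl , refl)))) = a≢d refl
  no-loop ((_ ∷ _ ∷ a≢d ∷ _) ∷ _) (inj₂ (inj₂ (inj₂ (refl , refl)))) = a≢d refl

swap : (G : Graph n) → ∀ {a b c d} (ok : Swappable G a b c d) → Swap G (swappedGraph G ok)
swap G {a} {b} {c} {d} ok = record
  { a = a ; b = b ; c = c ; d = d
  ; distinct = distinct ; ac∈G = ac∈G ; bd∈G = bd∈G ; bc∉G = bc∉G ; ad∉G = ad∉G
  ; result = λ u v → mk⇔ (T-does (afterSwap? G a b c d u v)) (does-T (afterSwap? G a b c d u v))
  }
  where open Swappable ok

module SwapProperties {G G′ : Graph n} (S : Swap G G′) where

  open Swap S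
  open Equivalence

  private
    separate : Unique (a ∷ b ∷ c ∷ d ∷ []) →
               (a , c) ≉ᴱ (b , d) × (a , c) ≉ᴱ (b , c) × (a , c) ≉ᴱ (a , d) ×
               (b , d) ≉ᴱ (b , c) × (b , d) ≉ᴱ (a , d) × (b , c) ≉ᴱ (a , d)
    separate ((a≢b ∷ a≢c ∷ a≢d ∷ []) ∷ (b≢c ∷ b≢d ∷ []) ∷ (c≢d ∷ []) ∷ [] ∷ []) =
        (λ { (inj₁ (p , _)) → a≢b p ; (inj₂ (p , _)) → a≢d p })
      , (λ { (inj₁ (p , _)) → a≢b p ; (inj₂ (p , _)) → a≢c p })
      , (λ { (inj₁ (_ , p)) → c≢d p ; (inj₂ (p , _)) → a≢d p })
      , (λ { (inj₁ (_ , p)) → c≢d (sym p) ; (inj₂ (p , _)) → b≢c p })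
      , (λ { (inj₁ (p , _)) → a≢b (sym p) ; (inj₂ (p , _)) → b≢d p })
      , (λ { (inj₁ (p , _)) → a≢b (sym p) ; (inj₂ (p , _)) → b≢d p })

  ac≉bd : (a , c) ≉ᴱ (b , d)
  ac≉bd = proj₁ (separate distinct)
  ac≉bc : (a , c) ≉ᴱ (b , c)
  ac≉bc = proj₁ (proj₂ (separate distinct))
  ac≉ad : (a , c) ≉ᴱ (a , d)
  ac≉ad = proj₁ (proj₂ (proj₂ (separate distinct)))
  bd≉bc : (b , d) ≉ᴱ (b , c)
  bd≉bc = proj₁ (proj₂ (proj₂ (proj₂ (separate distinct))))
  bd≉ad : (b , d) ≉ᴱ (a , d)
  bd≉ad = proj₁ (proj₂ (proj₂ (proj₂ (proj₂ (separate distinct)))))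
  bc≉ad : (b , c) ≉ᴱ (a , d)
  bc≉ad = proj₂ (proj₂ (proj₂ (proj₂ (proj₂ (separate distinct)))))

  both : ∀ {e f g : Fin n × Fin n} → e ≈ᴱ f → e ≈ᴱ g → f ≈ᴱ g
  both e≈f e≈g = ≈ᴱ-trans (≈ᴱ-sym e≈f) e≈g

  removed : ∀ {u v} → (u , v) ≈ᴱ (a , c) ⊎ (u , v) ≈ᴱ (b , d) → ¬ Adj G′ u v
  removed {u} {v} old uv∈G′ with old | result u v .to uv∈G′
  ... | inj₁ p | inj₁ (_ , ≉ac , _) = ≉ac p
  ... | inj₁ p | inj₂ (inj₁ q)      = ac≉bc (both p q)
  ... | inj₁ p | inj₂ (inj₂ q)      = ac≉ad (both p q)
  ... | inj₂ p | inj₁ (_ , _ , ≉bd) = ≉bd p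
  ... | inj₂ p | inj₂ (inj₁ q)      = bd≉bc (both p q)
  ... | inj₂ p | inj₂ (inj₂ q)      = bd≉ad (both p q)

  -- The four edges of a swap are pairwise different, so at most one of the indicators is 1 at a
  -- given pair. This is the additive form in which a swap enters the balance of `Links`.
  edge-balance : ∀ u v →
    𝔟 (edge G′ u v) + (𝟙 ((u , v) ≈ᴱ? (a , c)) + 𝟙 ((u , v) ≈ᴱ? (b , d))) ≡
    𝔟 (edge G u v)  + (𝟙 ((u , v) ≈ᴱ? (b , c)) + 𝟙 ((u , v) ≈ᴱ? (a , d)))
  edge-balance u v = go (_ ≈ᴱ? _) (_ ≈ᴱ? _) (_ ≈ᴱ? _) (_ ≈ᴱ? _)
    where
    b₁ b₀ : ℕ
    b₁ = 𝔟 (edge G′ u v)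
    b₀ = 𝔟 (edge G u v)
    old : b₁ ≡ 0 → b₀ ≡ 1 → b₁ + 1 ≡ b₀ + 0
    old p q rewrite p | q = refl
    new : b₁ ≡ 1 → b₀ ≡ 0 → b₁ + 0 ≡ b₀ + 1
    new p q rewrite p | q = refl
    go : (p : Dec ((u , v) ≈ᴱ (a , c))) (q : Dec ((u , v) ≈ᴱ (b , d)))
         (r : Dec ((u , v) ≈ᴱ (b , c))) (s : Dec ((u , v) ≈ᴱ (a , d))) →
         b₁ + (𝟙 p + 𝟙 q) ≡ b₀ + (𝟙 r + 𝟙 s)
    go (yes p) (yes q) _       _       = ⊥-elim (ac≉bd (both p q))
    go (yes p) _       (yes r) _       = ⊥-elim (ac≉bc (both p r))
    go (yes p) _       _       (yes s) = ⊥-elim (ac≉ad (both p s))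
    go _       (yes q) (yes r) _       = ⊥-elim (bd≉bc (both q r))
    go _       (yes q) _       (yes s) = ⊥-elim (bd≉ad (both q s))
    go _       _       (yes r) (yes s) = ⊥-elim (bc≉ad (both r s))
    go (yes p) (no _)  (no _)  (no _)  = old (𝔟-false (removed (inj₁ p))) (𝔟-true (adj-resp G p ac∈G))
    go (no _)  (yes q) (no _)  (no _)  = old (𝔟-false (removed (inj₂ q))) (𝔟-true (adj-resp G q bd∈G))
    go (no _)  (no _)  (yes r) (no _)  = new (𝔟-true (result u v .from (inj₂ (inj₁ r)))) (𝔟-false (bc∉G ∘ adj-resp G (≈ᴱ-sym r)))
    go (no _)  (no _)  (no _)  (yes s) = new (𝔟-true (result u v .from (inj₂ (inj₂ s)))) (𝔟-false (ad∉G ∘ adj-resp G (≈ᴱ-sym s)))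
    go (no ¬p) (no ¬q) (no ¬r) (no ¬s) = cong (_+ 0) (𝔟-cong forth back)
      where
      forth : Adj G′ u v → Adj G u v
      forth uv∈G′ with result u v .to uv∈G′
      ... | inj₁ (uv∈G , _) = uv∈G
      ... | inj₂ (inj₁ r)   = ⊥-elim (¬r r)
      ... | inj₂ (inj₂ s)   = ⊥-elim (¬s s)
      back : Adj G u v → Adj G′ u v
      back uv∈G = result u v .from (inj₁ (uv∈G , ¬p , ¬q))

  -- Exchanging `a` and `b` turns the new edges of a swap into the old ones.
  inverse : Swap G′ G
  inverse = record
    { a = b ; b = a ; c = c ; d = d
    ; distinct = transpose distinct
    ; ac∈G = result b c .from (inj₂ (inj₁ (inj₁ (refl , refl))))
    ; bd∈G = result a d .from (inj₂ (inj₂ (inj₁ (refl , refl))))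
    ; bc∉G = removed (inj₁ (inj₁ (refl , refl)))
    ; ad∉G = removed (inj₂ (inj₁ (refl , refl)))
    ; result = λ u v → mk⇔ (forth u v) (back u v)
    }
    where
    transpose : Unique (a ∷ b ∷ c ∷ d ∷ []) → Unique (b ∷ a ∷ c ∷ d ∷ [])
    transpose ((a≢b ∷ a≢cd) ∷ b≢cd ∷ rest) = ((a≢b ∘ sym) ∷ b≢cd) ∷ a≢cd ∷ rest
    forth : ∀ u v → Adj G u v → AfterSwap G′ b a c d u v
    forth u v uv∈G with (u , v) ≈ᴱ? (a , c) | (u , v) ≈ᴱ? (b , d)
    ... | yes p | _     = inj₂ (inj₁ p)
    ... | no _  | yes q = inj₂ (inj₂ q)
    ... | no ¬p | no ¬q = inj₁ ( result u v .from (inj₁ (uv∈G , ¬p , ¬q))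
                               , (λ r → bc∉G (adj-resp G (≈ᴱ-sym r) uv∈G))
                               , (λ s → ad∉G (adj-resp G (≈ᴱ-sym s) uv∈G)) )
    back : ∀ u v → AfterSwap G′ b a c d u v → Adj G u v
    back u v (inj₂ (inj₁ p)) = adj-resp G p ac∈G
    back u v (inj₂ (inj₂ q)) = adj-resp G q bd∈G
    back u v (inj₁ (uv∈G′ , ≉bc , ≉ad)) with result u v .to uv∈G′
    ... | inj₁ (uv∈G , _) = uv∈G
    ... | inj₂ (inj₁ r)   = ⊥-elim (≉bc r)
    ... | inj₂ (inj₂ s)   = ⊥-elim (≉ad s)

swap-resp : G ≈ᴳ G₁ → Swap G H → Swap G₁ H
swap-resp {G = G} {G₁ = G₁} {H = H} G≈G₁ S = record
  { a = a ; b = b ; c = c ; d = d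
  ; distinct = distinct
  ; ac∈G = subst T (G≈G₁ a c) ac∈G
  ; bd∈G = subst T (G≈G₁ b d) bd∈G
  ; bc∉G = bc∉G ∘ subst T (sym (G≈G₁ b c))
  ; ad∉G = ad∉G ∘ subst T (sym (G≈G₁ a d))
  ; result = λ u v → subst (λ e → T (edge H u v) ⇔ ((T e × _) ⊎ _)) (G≈G₁ u v) (result u v)
  }
  where open Swap S

sequence-resp : ∀ {k} → G ≈ᴳ G₁ → SwapSequence G H k → SwapSequence G₁ H k
sequence-resp G≈G₁ (done G≈H) = done λ u v → trans (sym (G≈G₁ u v)) (G≈H u v)
sequence-resp {G = G} {G₁ = G₁} G≈G₁ (step {G′ = G′} S σ) = step (swap-resp {G = G} {G₁ = G₁} {H = G′} G≈G₁ S) σ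

sequence-snoc : ∀ {k} → SwapSequence G H₁ k → Swap H₁ H → SwapSequence G H (suc k)
sequence-snoc {G = G} {H₁ = H₁} {H = H} (done G≈H₁) S =
  step (swap-resp {G = H₁} {G₁ = G} {H = H} (λ u v → sym (G≈H₁ u v)) S) (done λ _ _ → refl)
sequence-snoc (step S′ σ) S = step S′ (sequence-snoc σ S)

sequence-reverse : ∀ {k} → SwapSequence G H k → SwapSequence H G k
sequence-reverse (done G≈H) = done λ u v → sym (G≈H u v)
sequence-reverse (step S σ) = sequence-snoc (sequence-reverse σ) (SwapProperties.inverse S)

swap-to : ∀ {k} → Swap H H₁ → SwapSequence G H₁ k → SwapSequence G H (suc k)
swap-to S σ = sequence-snoc σ (SwapProperties.inverse S)

-- Up to equality of edge sets a swap is determined by its four vertices, so the search for the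
-- first swap is finite. Decidability is what makes a shortest sequence available.
sequence? : ∀ k (G H : Graph n) → Dec (SwapSequence G H k)
sequence? zero G H =
  map′ done (λ { (done G≈H) → G≈H }) (all? λ u → all? λ v → edge G u v ≟ᵇ edge H u v)
sequence? {n} (suc k) G H = map′ to from
  (any? λ a → any? λ b → any? λ c → any? λ d → first-step? a b c d)
  where
  FirstStep : Fin n → Fin n → Fin n → Fin n → Set
  FirstStep a b c d = Σ (Swappable G a b c d) λ ok → SwapSequence (swappedGraph G ok) H k
  first-step? : ∀ a b c d → Dec (FirstStep a b c d)
  first-step? a b c d with swappable? G a b c d
  ... | no ¬ok = no (¬ok ∘ proj₁)
  ... | yes ok = map′ (ok ,_) (λ (_ , σ) → sequence-resp (λ _ _ → refl) σ)
                      (sequence? k (swappedGraph G ok) H)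
  to : (∃ λ a → ∃ λ b → ∃ λ c → ∃ λ d → FirstStep a b c d) → SwapSequence G H (suc k)
  to (a , b , c , d , ok , σ) = step (swap G ok) σ
  from : SwapSequence G H (suc k) → ∃ λ a → ∃ λ b → ∃ λ c → ∃ λ d → FirstStep a b c d
  from (step {G′ = G′} S σ) = a , b , c , d , ok , sequence-resp agree σ
    where
    open Swap S
    ok : Swappable G a b c d
    ok = record { distinct = distinct ; ac∈G = ac∈G ; bd∈G = bd∈G ; bc∉G = bc∉G ; ad∉G = ad∉G }
    agree : G′ ≈ᴳ swappedGraph G ok
    agree u v = 𝔟-injective _ _ (𝔟-cong
      (does-T (afterSwap? G a b c d u v) ∘ Equivalence.to (result u v))
      (Equivalence.from (result u v) ∘ T-does (afterSwap? G a b c d u v)))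

least : ∀ {P : ℕ → Set} → (∀ k → Dec (P k)) → ∀ k → P k → ∃ λ m → P m × (∀ j → P j → m ≤ j)
least P? k pk with P? 0
... | yes p0 = 0 , p0 , λ _ _ → z≤n
least P? zero    pk | no ¬p0 = contradiction pk ¬p0
least {P} P? (suc k) pk | no ¬p0 with m , pm , minimal ← least (P? ∘ suc) k pk = suc m , pm , bound
  where
  bound : ∀ j → P j → suc m ≤ j
  bound zero    p0 = contradiction p0 ¬p0
  bound (suc j) pj = s≤s (minimal j pj)

-- From circuits to swap sequences

reduced-resp : (∀ f → ∥ D ∥* f ≡ ∥ D′ ∥* f) → Reduced D → Reduced D′
reduced-resp eq red-D u v (r , b) =
  red-D u v (≤-trans r (≤-reflexive (sym (eq _))) , ≤-trans b (≤-reflexive (sym (eq _))))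

-- The removed pair contributes equally to both sides of every balance equation.
links-cancel : Opp κ κ̄ → Links κ κ̄ G H D → (k : Cancelled D u v) → Links κ κ̄ G H (Cancelled.remaining k)
links-cancel {κ = κ} {κ̄ = κ̄} {G = G} {H = H} {D = D} {u = u} {v = v} o links k = linking λ x y → go x y o (balance links x y)
  where
  open Cancelled k
  cancel-both : ∀ g h e B R → g + (e + B) ≡ h + (e + R) → g + B ≡ h + R
  cancel-both g h e B R eq = +-cancelˡ-≡ e _ _ (begin
    e + (g + B)  ≡⟨ solve 3 (λ e g b → e :+ (g :+ b) := g :+ (e :+ b)) refl e g B ⟩
    g + (e + B)  ≡⟨ eq ⟩
    h + (e + R)  ≡⟨ solve 3 (λ e g b → g :+ (e :+ b) := e :+ (g :+ b)) refl e h R ⟩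
    e + (h + R)  ∎)
    where open ≡-Reasoning
  go : ∀ x y → Opp κ κ̄ → 𝔟 (edge G x y) + ∥ D ∥* (δ κ̄ x y) ≡ 𝔟 (edge H x y) + ∥ D ∥* (δ κ x y) →
       𝔟 (edge G x y) + ∥ remaining ∥* (δ κ̄ x y) ≡ 𝔟 (edge H x y) + ∥ remaining ∥* (δ κ x y)
  go x y rb eq rewrite sums (δ red x y) | sums (δ blue x y) | +-identityʳ (𝟙 ((x , y) ≈ᴱ? (u , v))) =
    cancel-both (𝔟 (edge G x y)) (𝔟 (edge H x y)) (𝟙 ((x , y) ≈ᴱ? (u , v))) (∥ remaining ∥* (δ blue x y)) (∥ remaining ∥* (δ red x y)) eq
  go x y br eq rewrite sums (δ red x y) | sums (δ blue x y) | +-identityʳ (𝟙 ((x , y) ≈ᴱ? (u , v))) =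
    cancel-both (𝔟 (edge G x y)) (𝔟 (edge H x y)) (𝟙 ((x , y) ≈ᴱ? (u , v))) (∥ remaining ∥* (δ red x y)) (∥ remaining ∥* (δ blue x y)) eq

-- In a reduced family the other colour is absent at `uv`. The balance then says that the indicator
-- in `G` exceeds that in `H` by a positive number, which forces the values 1 and 0.
edge-of-colour : ∀ u v → Opp κ κ̄ → Links κ κ̄ G H D → Reduced D → 1 ≤ ∥ D ∥* (δ κ u v) → Adj G u v × ¬ Adj H u v
edge-of-colour {κ = κ} {κ̄ = κ̄} {G = G} {H = H} {D = D} u v o links reduced le =
  surplus (edge G u v) (edge H u v) le (trans (cong (𝔟 (edge G u v) +_) (sym (κ̄-free o le))) (balance links u v))
  where
  surplus : ∀ a b {k} → 1 ≤ k → 𝔟 a + 0 ≡ 𝔟 b + k → T a × ¬ T b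
  surplus true  false _       _  = tt , λ ()
  surplus true  true  (s≤s _) ()
  surplus false true  (s≤s _) ()
  surplus false false (s≤s _) ()
  κ̄-free : Opp κ κ̄ → 1 ≤ ∥ D ∥* (δ κ u v) → ∥ D ∥* (δ κ̄ u v) ≡ 0
  κ̄-free rb le = n<1⇒n≡0 (≰⇒> λ le′ → reduced u v (le , le′))
  κ̄-free br le = n<1⇒n≡0 (≰⇒> λ le′ → reduced u v (le′ , le))

colour-of-edge : Links κ κ̄ G H D → Adj G u v → ¬ Adj H u v → 1 ≤ ∥ D ∥* (δ κ u v)
colour-of-edge {κ = κ} {κ̄ = κ̄} {G = G} {H = H} {D = D} {u = u} {v = v} links uv∈G uv∉H = begin
  1                                         ≡⟨ sym (𝔟-true uv∈G) ⟩
  𝔟 (edge G u v)                            ≤⟨ m≤m+n _ _ ⟩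
  𝔟 (edge G u v) + ∥ D ∥* (δ κ̄ u v)         ≡⟨ balance links u v ⟩
  𝔟 (edge H u v) + ∥ D ∥* (δ κ u v)         ≡⟨ cong (_+ ∥ D ∥* (δ κ u v)) (𝔟-false uv∉H) ⟩
  ∥ D ∥* (δ κ u v)                          ∎
  where open ≤-Reasoning

-- Only the last edge of such a walk can be at x, and it does not have colour κ.
avoids-colour : ∀ κ (x v : Fin n) {s} {p : Path s (κ , x)} → Avoids x p → ∥ p ∥ (δ κ x v) ≡ 0
avoids-colour κ x v nil = refl
avoids-colour κ x v (cons {κ′} {w = w} {o = o} {u≢w} {p} u≢x av) = cong₂ _+_ first (avoids-colour κ x v av)
  where
  never-back : ∀ {κ̄} {p : Path (κ̄ , x) (κ , x)} → Opp κ κ̄ → ¬ Avoids x p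
  never-back () nil
  never-back _  (cons x≢x _) = x≢x refl
  first : matching κ κ′ (𝟙 ((x , v) ≈ᴱ? (_ , w))) ≡ 0
  first with opp-cases o κ
  ... | inj₂ refl = matching-opp (opp-sym o)
  ... | inj₁ refl = trans (matching-same κ) (𝟙-no ((x , v) ≈ᴱ? (_ , w))
                      λ { (inj₁ (refl , _)) → u≢x refl ; (inj₂ (refl , _)) → never-back o av })

-- The number of swaps is at most half the number of edges minus the number of circuits; `bound` is
-- doubled and rearranged to avoid division and subtraction.
record Reach {n : ℕ} (G H : Graph n) (D : List (Circuit n)) : Set where
  constructor reach
  field
    {swaps}  : ℕ
    sequence : SwapSequence G H swaps
    bound    : 2 * (swaps + length D) ≤ ∥ D ∥* one


reach-sym : Reach G H D → Reach H G D
reach-sym (reach σ le) = reach (sequence-reverse σ) le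

-- At a fixed pair of vertices, `e₀₁`, `e₂₁`, `e₂₃`, `e₀₃` are the indicators of the sides of the
-- quadrilateral `u₀u₁u₂u₃`, and `B`, `R` count the remaining edges of the two colours. The balance
-- of the swap is added to that of the family, and common terms cancel.
swap-balanceˡ : ∀ g g′ h e₀₁ e₂₁ e₂₃ e₀₃ B R →
  g′ + (e₀₁ + e₂₃) ≡ g + (e₂₁ + e₀₃) →
  g + (e₂₁ + B) ≡ h + ((e₀₁ + e₂₃) + R) → g′ + B ≡ h + (e₀₃ + R)
swap-balanceˡ g g′ h e₀₁ e₂₁ e₂₃ e₀₃ B R swapped links = +-cancelʳ-≡ ((e₀₁ + e₂₃) + e₂₁) _ _ (begin
  (g′ + B) + ((e₀₁ + e₂₃) + e₂₁)
    ≡⟨ solve 4 (λ g b e f → (g :+ b) :+ (e :+ f) := (g :+ e) :+ (f :+ b)) refl g′ B (e₀₁ + e₂₃) e₂₁ ⟩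
  (g′ + (e₀₁ + e₂₃)) + (e₂₁ + B)
    ≡⟨ cong (_+ (e₂₁ + B)) swapped ⟩
  (g + (e₂₁ + e₀₃)) + (e₂₁ + B)
    ≡⟨ solve 4 (λ g b e f → (g :+ (f :+ e)) :+ (f :+ b) := (g :+ (f :+ b)) :+ (f :+ e)) refl g B e₀₃ e₂₁ ⟩
  (g + (e₂₁ + B)) + (e₂₁ + e₀₃)
    ≡⟨ cong (_+ (e₂₁ + e₀₃)) links ⟩
  (h + ((e₀₁ + e₂₃) + R)) + (e₂₁ + e₀₃)
    ≡⟨ solve 5 (λ h e r f i → (h :+ (e :+ r)) :+ (f :+ i) := (h :+ (i :+ r)) :+ (e :+ f)) refl h (e₀₁ + e₂₃) R e₂₁ e₀₃ ⟩
  (h + (e₀₃ + R)) + ((e₀₁ + e₂₃) + e₂₁) ∎)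
  where open ≡-Reasoning

swap-balanceʳ : ∀ g h h′ e₀₁ e₂₁ e₂₃ e₀₃ B R →
  h′ + (e₀₃ + e₂₁) ≡ h + (e₂₃ + e₀₁) →
  g + (e₂₁ + B) ≡ h + ((e₀₁ + e₂₃) + R) → g + B ≡ h′ + (e₀₃ + R)
swap-balanceʳ g h h′ e₀₁ e₂₁ e₂₃ e₀₃ B R swapped links = +-cancelʳ-≡ e₂₁ _ _ (begin
  (g + B) + e₂₁               ≡⟨ solve 3 (λ g b e → (g :+ b) :+ e := g :+ (e :+ b)) refl g B e₂₁ ⟩
  g + (e₂₁ + B)               ≡⟨ links ⟩
  h + ((e₀₁ + e₂₃) + R)       ≡⟨ solve 4 (λ h e f r → h :+ ((e :+ f) :+ r) := (h :+ (f :+ e)) :+ r) refl h e₀₁ e₂₃ R ⟩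
  (h + (e₂₃ + e₀₁)) + R       ≡⟨ cong (_+ R) (sym swapped) ⟩
  (h′ + (e₀₃ + e₂₁)) + R      ≡⟨ solve 4 (λ h e f r → (h :+ (e :+ f)) :+ r := (h :+ (e :+ r)) :+ f) refl h′ e₀₃ e₂₁ R ⟩
  (h′ + (e₀₃ + R)) + e₂₁      ∎)
  where open ≡-Reasoning

-- The swap on the quadrilateral in `G` and the one in `H` change the surplus of `G` over `H` alike:
-- the walk `u₀u₁u₂u₃` gives way to the chord `u₀u₃` in colour `κ`. `X` collects all other edges of
-- the family.
shortcut : ∀ {n κ κ̄} {G H : Graph n} {D D′ : List (Circuit n)} → Opp κ κ̄ → (u₀ u₁ u₂ u₃ : Fin n) → {X : Weight n → ℕ} →
  (∀ f → ∥ D ∥* f ≡ weight f κ̄ u₂ u₁ + ((weight f κ u₀ u₁ + weight f κ u₂ u₃) + X f)) →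
  (∀ f → ∥ D′ ∥* f ≡ weight f κ u₀ u₃ + X f) →
  Links κ κ̄ G H D →
  ((ok : Swappable G u₀ u₂ u₁ u₃) → Links κ κ̄ (swappedGraph G ok) H D′) ×
  ((ok : Swappable H u₀ u₂ u₃ u₁) → Links κ κ̄ G (swappedGraph H ok) D′)
shortcut {n} {κ} {κ̄} {G} {H} {D} {D′} o u₀ u₁ u₂ u₃ {X} D-sums D′-sums links = left , right
  where
  module _ (x y : Fin n) where
    e₀₁ = 𝟙 ((x , y) ≈ᴱ? (u₀ , u₁))
    e₂₁ = 𝟙 ((x , y) ≈ᴱ? (u₂ , u₁))
    e₂₃ = 𝟙 ((x , y) ≈ᴱ? (u₂ , u₃))
    e₀₃ = 𝟙 ((x , y) ≈ᴱ? (u₀ , u₃))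
    κ-sum : ∥ D ∥* (δ κ x y) ≡ (e₀₁ + e₂₃) + X (δ κ x y)
    κ-sum = trans (D-sums (δ κ x y)) (cong₂ _+_ (matching-opp o)
              (cong (_+ X (δ κ x y)) (cong₂ _+_ (matching-same κ) (matching-same κ))))
    κ̄-sum : ∥ D ∥* (δ κ̄ x y) ≡ e₂₁ + X (δ κ̄ x y)
    κ̄-sum = trans (D-sums (δ κ̄ x y)) (cong₂ _+_ (matching-same κ̄)
              (cong (_+ X (δ κ̄ x y)) (cong₂ _+_ (matching-opp (opp-sym o)) (matching-opp (opp-sym o)))))
    κ-sum′ : ∥ D′ ∥* (δ κ x y) ≡ e₀₃ + X (δ κ x y)
    κ-sum′ = trans (D′-sums (δ κ x y)) (cong (_+ X (δ κ x y)) (matching-same κ))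
    κ̄-sum′ : ∥ D′ ∥* (δ κ̄ x y) ≡ X (δ κ̄ x y)
    κ̄-sum′ = trans (D′-sums (δ κ̄ x y)) (cong (_+ X (δ κ̄ x y)) (matching-opp (opp-sym o)))
    before : 𝔟 (edge G x y) + (e₂₁ + X (δ κ̄ x y)) ≡ 𝔟 (edge H x y) + ((e₀₁ + e₂₃) + X (δ κ x y))
    before = subst₂ (λ B R → 𝔟 (edge G x y) + B ≡ 𝔟 (edge H x y) + R) κ̄-sum κ-sum (balance links x y)
  left : (ok : Swappable G u₀ u₂ u₁ u₃) → Links κ κ̄ (swappedGraph G ok) H D′
  left ok = linking λ x y → subst₂ (λ B R → 𝔟 (edge (swappedGraph G ok) x y) + B ≡ 𝔟 (edge H x y) + R)
    (sym (κ̄-sum′ x y)) (sym (κ-sum′ x y))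
    (swap-balanceˡ (𝔟 (edge G x y)) (𝔟 (edge (swappedGraph G ok) x y)) (𝔟 (edge H x y)) (e₀₁ x y) (e₂₁ x y) (e₂₃ x y) (e₀₃ x y) (X (δ κ̄ x y)) (X (δ κ x y))
      (SwapProperties.edge-balance (swap G ok) x y) (before x y))
  right : (ok : Swappable H u₀ u₂ u₃ u₁) → Links κ κ̄ G (swappedGraph H ok) D′
  right ok = linking λ x y → subst₂ (λ B R → 𝔟 (edge G x y) + B ≡ 𝔟 (edge (swappedGraph H ok) x y) + R)
    (sym (κ̄-sum′ x y)) (sym (κ-sum′ x y))
    (swap-balanceʳ (𝔟 (edge G x y)) (𝔟 (edge H x y)) (𝔟 (edge (swappedGraph H ok) x y)) (e₀₁ x y) (e₂₁ x y) (e₂₃ x y) (e₀₃ x y) (X (δ κ̄ x y)) (X (δ κ x y))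
      (SwapProperties.edge-balance (swap H ok) x y) (before x y))

-- The induction hypothesis after a swap: the family loses edges and one of the graphs changes, so
-- the graphs vary here. `ReachableIfShorter` serves the trade of a chord, which leaves both graphs
-- and the total number of edges alone.
ReachableIfFewer : Colour → Colour → List (Circuit n) → Set
ReachableIfFewer {n} κ κ̄ D =
  ∀ (D₁ : List (Circuit n)) {G H} → ∥ D₁ ∥* one < ∥ D ∥* one → Links κ κ̄ G H D₁ → Reach G H D₁

ReachableIfShorter : Colour → Colour → Graph n → Graph n → Circuit n → List (Circuit n) → Set
ReachableIfShorter {n} κ κ̄ G H C D =
  ∀ (C₁ : Circuit n) (D₁ : List (Circuit n)) → ∥ C₁ ∷ D₁ ∥* one ≡ ∥ C ∷ D ∥* one → ∥ C₁ ∥ᶜ one < ∥ C ∥ᶜ one →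
  Links κ κ̄ G H (C₁ ∷ D₁) → Reach G H (C₁ ∷ D₁)

δ-positive : ∀ κ (u v : Fin n) → 1 ≤ weight (δ κ u v) κ u v
δ-positive κ u v = ≤-reflexive (sym (trans (matching-same κ) (𝟙-yes ((u , v) ≈ᴱ? (u , v)) (inj₁ (refl , refl)))))

avoids-start : Opp κ κ̄ → {p : Path (κ̄ , w) (κ , u)} → Avoids u p → w ≢ u
avoids-start () nil
avoids-start _  (cons w≢u _) = w≢u

-- Each swap takes two edges and no circuit from the family, which is exactly what the bound grants
-- for one swap; the trade of a chord costs nothing.
advance-long : {G H : Graph n} {u₀ u₁ u₂ u₃ : Fin n} (o o″ : Opp κ κ̄) (o′ : Opp κ̄ κ)
  (u₀≢u₁ : u₀ ≢ u₁) (u₁≢u₂ : u₁ ≢ u₂) (u₂≢u₃ : u₂ ≢ u₃) (q : Path (κ̄ , u₃) (κ , u₀)) (D : List (Circuit n)) →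
  let C = circuit o u₀≢u₁ (cons o′ u₁≢u₂ (cons o″ u₂≢u₃ q)) in
  Avoids u₀ (cons o″ u₂≢u₃ q) → Reduced (C ∷ D) → Links κ κ̄ G H (C ∷ D) →
  ReachableIfFewer κ κ̄ (C ∷ D) → ReachableIfShorter κ κ̄ G H C D → Reach G H (C ∷ D)
advance-long {n} {κ} {κ̄} {G} {H} {u₀} {u₁} {u₂} {u₃} o o″ o′ u₀≢u₁ u₁≢u₂ u₂≢u₃ q D (cons u₂≢u₀ av) reduced links fewer shorter =
  go (T? (edge G u₀ u₃)) (T? (edge H u₀ u₃))
  where
  C = circuit o u₀≢u₁ (cons o′ u₁≢u₂ (cons o″ u₂≢u₃ q))
  u₃≢u₀ : u₃ ≢ u₀
  u₃≢u₀ = avoids-start o av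
  u₀u₁ : Adj G u₀ u₁ × ¬ Adj H u₀ u₁
  u₀u₁ = edge-of-colour u₀ u₁ o links reduced
    (m≤n⇒m≤n+o _ (m≤n⇒m≤n+o _ (δ-positive κ u₀ u₁)))
  u₁u₂ : Adj H u₁ u₂ × ¬ Adj G u₁ u₂
  u₁u₂ = edge-of-colour u₁ u₂ (opp-sym o) (links-sym links) reduced
    (m≤n⇒m≤n+o _ (m≤n⇒m≤o+n (weight (δ κ̄ u₁ u₂) κ u₀ u₁) (m≤n⇒m≤n+o _ (δ-positive κ̄ u₁ u₂))))
  u₂u₃ : Adj G u₂ u₃ × ¬ Adj H u₂ u₃
  u₂u₃ = edge-of-colour u₂ u₃ o links reduced
    (m≤n⇒m≤n+o _ (m≤n⇒m≤o+n (weight (δ κ u₂ u₃) κ u₀ u₁)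
      (m≤n⇒m≤o+n (weight (δ κ u₂ u₃) κ̄ u₁ u₂) (m≤n⇒m≤n+o _ (δ-positive κ u₂ u₃)))))
  -- Otherwise one and the same edge would lie in `G` as `u₂u₃` and outside `G` as `u₁u₂`.
  u₁≢u₃ : u₁ ≢ u₃
  u₁≢u₃ refl = proj₂ u₁u₂ (adj-resp G {u₁ , u₂} {u₂ , u₁} (inj₂ (refl , refl)) (proj₁ u₂u₃))

  C₁ = circuit o (u₃≢u₀ ∘ sym) q
  rest : Weight n → ℕ
  rest f = ∥ q ∥ f + ∥ D ∥* f
  old-sums : ∀ f → ∥ C ∷ D ∥* f ≡ weight f κ̄ u₂ u₁ + ((weight f κ u₀ u₁ + weight f κ u₂ u₃) + rest f)
  old-sums f = trans
    (solve 5 (λ a b c q d → (a :+ (b :+ (c :+ q))) :+ d := b :+ ((a :+ c) :+ (q :+ d))) refl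
      (weight f κ u₀ u₁) (weight f κ̄ u₁ u₂) (weight f κ u₂ u₃) (∥ q ∥ f) (∥ D ∥* f))
    (cong (_+ ((weight f κ u₀ u₁ + weight f κ u₂ u₃) + rest f)) (weight-sym f κ̄ u₁ u₂))
  new-sums : ∀ f → ∥ C₁ ∷ D ∥* f ≡ weight f κ u₀ u₃ + rest f
  new-sums f = +-assoc (weight f κ u₀ u₃) _ _

  swapped-bound : ∀ j → 2 * (j + length (C₁ ∷ D)) ≤ ∥ C₁ ∷ D ∥* one → 2 * (suc j + length (C ∷ D)) ≤ ∥ C ∷ D ∥* one
  swapped-bound j le = ≤-trans (≤-reflexive (*-suc 2 (j + length (C ∷ D)))) (s≤s (s≤s le))

  -- Visited once, `u₀` has only one edge of colour `κ` in `C`, and this is `u₀u₁`.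
  chord∉C : ∥ C ∥ᶜ (δ κ u₀ u₃) ≡ 0
  chord∉C = cong₂ _+_ (trans (matching-same κ) (𝟙-no ((u₀ , u₃) ≈ᴱ? (u₀ , u₁))
                λ { (inj₁ (_ , p)) → u₁≢u₃ (sym p) ; (inj₂ (p , _)) → u₀≢u₁ p }))
           (cong₂ _+_ (matching-opp o)
           (cong₂ _+_ (trans (matching-same κ) (𝟙-no ((u₀ , u₃) ≈ᴱ? (u₂ , u₃))
                λ { (inj₁ (p , _)) → u₂≢u₀ (sym p) ; (inj₂ (p , _)) → u₃≢u₀ (sym p) }))
             (avoids-colour κ u₀ u₃ av)))

  distinct : Unique (u₀ ∷ u₂ ∷ u₁ ∷ u₃ ∷ [])
  distinct = ((u₂≢u₀ ∘ sym) ∷ u₀≢u₁ ∷ (u₃≢u₀ ∘ sym) ∷ []) ∷ ((u₁≢u₂ ∘ sym) ∷ u₂≢u₃ ∷ []) ∷ (u₁≢u₃ ∷ []) ∷ [] ∷ []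
  distinct′ : Unique (u₀ ∷ u₂ ∷ u₃ ∷ u₁ ∷ [])
  distinct′ = ((u₂≢u₀ ∘ sym) ∷ (u₃≢u₀ ∘ sym) ∷ u₀≢u₁ ∷ []) ∷ (u₂≢u₃ ∷ (u₁≢u₂ ∘ sym) ∷ []) ∷ ((u₁≢u₃ ∘ sym) ∷ []) ∷ [] ∷ []

  go : Dec (Adj G u₀ u₃) → Dec (Adj H u₀ u₃) → Reach G H (C ∷ D)
  -- If `H` has the chord, then after the swap the family contains it in both colours, and this
  -- clash is left to later steps. A circuit of four edges falls under this case and shrinks to a
  -- parallel pair, so it needs no separate treatment.
  go (no u₀u₃∉G) _ = reach (step (swap G ok) sequence) (swapped-bound swaps bound)
    where
    ok : Swappable G u₀ u₂ u₁ u₃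
    ok = record { distinct = distinct ; ac∈G = proj₁ u₀u₁ ; bd∈G = proj₁ u₂u₃
                ; bc∉G = proj₂ u₁u₂ ∘ adj-resp G {u₁ , u₂} {u₂ , u₁} (inj₂ (refl , refl)) ; ad∉G = u₀u₃∉G }
    open Reach (fewer (C₁ ∷ D) (s≤s (n≤1+n _)) (proj₁ (shortcut o u₀ u₁ u₂ u₃ old-sums new-sums links) ok))
  -- With the chord in both graphs, the swap removes it from `H`; its inverse becomes the last swap
  -- of the sequence.
  go (yes _) (yes u₀u₃∈H) = reach (swap-to (swap H ok) sequence) (swapped-bound swaps bound)
    where
    ok : Swappable H u₀ u₂ u₃ u₁
    ok = record { distinct = distinct′ ; ac∈G = u₀u₃∈H ; bd∈G = adj-resp H {u₂ , u₁} {u₁ , u₂} (inj₂ (refl , refl)) (proj₁ u₁u₂)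
                ; bc∉G = proj₂ u₂u₃ ; ad∉G = proj₂ u₀u₁ }
    open Reach (fewer (C₁ ∷ D) (s≤s (n≤1+n _)) (proj₂ (shortcut o u₀ u₁ u₂ u₃ old-sums new-sums links) ok))
  -- The chord must occur in colour `κ`, hence in a circuit of `D`. That circuit receives the three
  -- edges for the chord, and the first circuit becomes two edges shorter.
  go (yes u₀u₃∈G) (no u₀u₃∉H) =
    reach sequence (subst₂ (λ a b → 2 * (swaps + a) ≤ b) (sym (cong suc count)) (sym (exchange one)) bound)
    where
    open OpenedIn (open-at u₀ u₃ o D (subst (λ z → 1 ≤ z + ∥ D ∥* (δ κ u₀ u₃)) chord∉C
      (colour-of-edge links u₀u₃∈G u₀u₃∉H))) hiding (distinct)
    C₂ = circuit o u₀≢u₁ (cons o′ u₁≢u₂ (cons o″ u₂≢u₃ path))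
    exchange : ∀ f → ∥ C ∷ D ∥* f ≡ ∥ C₁ ∷ C₂ ∷ others ∥* f
    exchange f = trans (cong (∥ C ∥ᶜ f +_) (sums f))
      (solve 7 (λ a b c q e p k → (a :+ (b :+ (c :+ q))) :+ (e :+ (p :+ k)) := (e :+ q) :+ ((a :+ (b :+ (c :+ p))) :+ k)) refl
         (weight f κ u₀ u₁) (weight f κ̄ u₁ u₂) (weight f κ u₂ u₃) (∥ q ∥ f) (weight f κ u₀ u₃) (∥ path ∥ f) (∥ others ∥* f))
    open Reach (shorter C₁ (C₂ ∷ others) (sym (exchange one)) (s≤s (s≤s (n≤1+n _))) (links-resp exchange links))

advance : {G H : Graph n} (o : Opp κ κ̄) (u≢w : u ≢ w) (p : Path (κ̄ , w) (κ , u)) (D : List (Circuit n)) →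
  let C = circuit o u≢w p in
  Avoids u p → Reduced (C ∷ D) → Links κ κ̄ G H (C ∷ D) →
  ReachableIfFewer κ κ̄ (C ∷ D) → ReachableIfShorter κ κ̄ G H C D → Reach G H (C ∷ D)
advance () u≢w nil D av reduced links fewer shorter
advance o u₀≢u₁ (cons o′ u₁≢u₂ p) D av reduced links fewer shorter with opp-unique o′ (opp-sym o)
-- A circuit of two edges would use `u₀u₁` in both colours.
advance {n} {κ} {κ̄} {u₀} {u₁} {G} {H} o u₀≢u₁ p@(cons o′ u₁≢u₂ nil) D av reduced links fewer shorter | refl =
  ⊥-elim (proj₂ u₁u₀ (adj-resp G {u₁ , u₀} {u₀ , u₁} (inj₂ (refl , refl)) (proj₁ u₀u₁)))
  where
  u₀u₁ : Adj G u₀ u₁ × ¬ Adj H u₀ u₁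
  u₀u₁ = edge-of-colour u₀ u₁ o links reduced (m≤n⇒m≤n+o _ (m≤n⇒m≤n+o _ (δ-positive κ u₀ u₁)))
  u₁u₀ : Adj H u₁ u₀ × ¬ Adj G u₁ u₀
  u₁u₀ = edge-of-colour u₁ u₀ (opp-sym o) (links-sym links) reduced
    (m≤n⇒m≤n+o _ (m≤n⇒m≤o+n (weight (δ κ̄ u₁ u₀) κ u₀ u₁) (m≤n⇒m≤n+o _ (δ-positive κ̄ u₁ u₀))))
advance o u₀≢u₁ (cons o′ u₁≢u₂ (cons o″ u₂≢u₃ q)) D (cons _ av) reduced links fewer shorter | refl
  with refl ← opp-unique o″ o = advance-long o o″ o′ u₀≢u₁ u₁≢u₂ u₂≢u₃ q D av reduced links fewer shorter

head-length : List (Circuit n) → ℕ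
head-length []      = 0
head-length (C ∷ D) = ∥ C ∥ᶜ one

Reachable : List (Circuit n) → Set
Reachable {n} D = ∀ {κ κ̄} {G H : Graph n} → Opp κ κ̄ → Links κ κ̄ G H D → Reach G H D

-- Parallel pairs are cancelled first, so that afterwards a colour reveals which graph has the edge.
-- A split adds a circuit, so it yields a stronger bound than required, and its first circuit is
-- shorter.
reach-step : (D : List (Circuit n)) →
  (∀ (D₁ : List (Circuit n)) → ∥ D₁ ∥* one < ∥ D ∥* one → Reachable D₁) →
  (∀ (D₁ : List (Circuit n)) → ∥ D₁ ∥* one ≡ ∥ D ∥* one → head-length D₁ < head-length D → Reachable D₁) →
  Reachable D
reach-step D fewer shorter {κ} {κ̄} {G} {H} o links with reduced? D
... | inj₂ (u , v , clash) =
  reach sequence (≤-trans (*-monoʳ-≤ 2 (≤-trans (+-monoʳ-≤ swaps count) (≤-reflexive (+-suc swaps (length remaining)))))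
    (≤-trans (≤-reflexive (*-suc 2 (swaps + length remaining))) (≤-trans (+-monoʳ-≤ 2 bound) (≤-reflexive (sym (sums one))))))
  where
  cancelled = cancel D u v clash
  open Cancelled cancelled
  open Reach (fewer remaining (≤-trans (n≤1+n _) (≤-reflexive (sym (sums one)))) o (links-cancel o links cancelled))
reach-step [] fewer shorter {κ} {κ̄} {G} {H} o links | inj₁ reduced =
  reach (done λ u v → 𝔟-injective _ _ (trans (sym (+-identityʳ _)) (trans (balance links u v) (+-identityʳ _)))) z≤n
reach-step (C ∷ D) fewer shorter {κ} {κ̄} {G} {H} o links | inj₁ reduced with analyse C
... | splits C₁ C₂ eq = reach sequence
        (≤-trans (*-monoʳ-≤ 2 (+-monoʳ-≤ swaps (n≤1+n _))) (≤-trans bound (≤-reflexive (sym (eq′ one)))))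
  where
  eq′ : ∀ f → ∥ C ∷ D ∥* f ≡ ∥ C₁ ∷ C₂ ∷ D ∥* f
  eq′ f = trans (cong (_+ ∥ D ∥* f) (eq f)) (+-assoc (∥ C₁ ∥ᶜ f) _ _)
  open Reach (shorter (C₁ ∷ C₂ ∷ D) (sym (eq′ one))
    (≤-trans (m<m+n (∥ C₁ ∥ᶜ one) (s≤s z≤n)) (≤-reflexive (sym (eq one)))) o (links-resp eq′ links))
... | simple C₁@(circuit {κ₁} o₁ u≢w p) av eq = reach sequence (subst (2 * (swaps + length (C ∷ D)) ≤_) (sym (eq′ one)) bound)
  where
  eq′ : ∀ f → ∥ C ∷ D ∥* f ≡ ∥ C₁ ∷ D ∥* f
  eq′ f = cong (_+ ∥ D ∥* f) (eq f)
  go : ∀ {κ κ̄} {G H : Graph _} → Opp κ κ̄ → κ₁ ≡ κ → Links κ κ̄ G H (C ∷ D) → Reach G H (C₁ ∷ D)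
  go o refl links with refl ← opp-unique o o₁ =
    advance o₁ u≢w p D av (reduced-resp {D = C ∷ D} {D′ = C₁ ∷ D} eq′ reduced) (links-resp eq′ links)
      (λ D₁ lt → fewer D₁ (≤-trans lt (≤-reflexive (sym (eq′ one)))) o)
      (λ C₂ D₁ same lt → shorter (C₂ ∷ D₁) (trans same (sym (eq′ one))) (≤-trans lt (≤-reflexive (sym (eq one)))) o)
  -- If `C₁` begins with `κ̄`, the graphs exchange roles and the sequence found is reversed.
  either : Reach G H (C₁ ∷ D)
  either with opp-cases o κ₁
  ... | inj₁ κ₁≡κ = go o κ₁≡κ links
  ... | inj₂ κ₁≡κ̄ = reach-sym (go (opp-sym o) κ₁≡κ̄ (links-sym links))
  open Reach either

reachable : (D : List (Circuit n)) → Reachable D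
reachable {n} D = <-rec P₁ outer (∥ D ∥* one) (head-length D) D refl refl
  where
  P₁ : ℕ → Set
  P₁ a = ∀ b (D : List (Circuit n)) → ∥ D ∥* one ≡ a → head-length D ≡ b → Reachable D
  outer : ∀ a → (∀ {a′} → a′ < a → P₁ a′) → P₁ a
  outer a ih = <-rec _ λ where
    b ih′ D refl refl → reach-step D
      (λ D₁ lt → ih lt (head-length D₁) D₁ refl refl)
      (λ D₁ same lt → ih′ lt D₁ same refl)

-- From swap sequences to circuits

record SwapCircuits {n : ℕ} (G H : Graph n) (k : ℕ) : Set where
  field
    circuits : List (Circuit n)
    links    : Links red blue G H circuits
    size-eq  : ∥ circuits ∥* one ≡ k * 4
    count    : length circuits ≡ k

-- Each swap contributes the circuit `a c b d`, red on the removed and blue on the new edges, and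
-- the surpluses telescope. An edge that is added and later removed again simply occurs in both
-- colours.
swap-circuits : ∀ {k} → SwapSequence G H k → SwapCircuits G H k
swap-circuits (done G≈H) = record
  { circuits = [] ; links = linking λ u v → cong (λ e → 𝔟 e + 0) (G≈H u v) ; size-eq = refl ; count = refl }
swap-circuits {G = G} {H = H} (step {G′ = G′} S σ) = record
  { circuits = C ∷ circuits
  ; links = linking bal
  ; size-eq = cong (4 +_) size-eq
  ; count = cong suc count
  }
  where
  open Swap S
  open SwapCircuits (swap-circuits σ)
  non-loops : Unique (a ∷ b ∷ c ∷ d ∷ []) → (a ≢ c × b ≢ c) × (b ≢ d × a ≢ d)
  non-loops ((_ ∷ a≢c ∷ a≢d ∷ []) ∷ (b≢c ∷ b≢d ∷ []) ∷ _) = (a≢c , b≢c) , (b≢d , a≢d)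
  C = circuit rb (proj₁ (proj₁ (non-loops distinct))) (cons br (proj₂ (proj₁ (non-loops distinct)) ∘ sym)
        (cons rb (proj₁ (proj₂ (non-loops distinct))) (cons br (proj₂ (proj₂ (non-loops distinct)) ∘ sym) nil)))
  C-red : ∀ x y → ∥ C ∥ᶜ (δ red x y) ≡ 𝟙 ((x , y) ≈ᴱ? (a , c)) + 𝟙 ((x , y) ≈ᴱ? (b , d))
  C-red x y = cong (𝟙 ((x , y) ≈ᴱ? (a , c)) +_) (+-identityʳ _)
  C-blue : ∀ x y → ∥ C ∥ᶜ (δ blue x y) ≡ 𝟙 ((x , y) ≈ᴱ? (b , c)) + 𝟙 ((x , y) ≈ᴱ? (a , d))
  C-blue x y = cong₂ _+_ (weight-sym (δ blue x y) blue c b) (trans (+-identityʳ _) (weight-sym (δ blue x y) blue d a))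
  bal : ∀ x y → 𝔟 (edge G x y) + ∥ C ∷ circuits ∥* (δ blue x y) ≡ 𝔟 (edge H x y) + ∥ C ∷ circuits ∥* (δ red x y)
  bal x y = begin
    g + (∥ C ∥ᶜ (δ blue x y) + B)       ≡⟨ cong (λ z → g + (z + B)) (C-blue x y) ⟩
    g + (new + B)                       ≡⟨ sym (+-assoc g new B) ⟩
    (g + new) + B                       ≡⟨ cong (_+ B) (sym (SwapProperties.edge-balance S x y)) ⟩
    (g′ + old) + B                      ≡⟨ solve 3 (λ g e b → (g :+ e) :+ b := e :+ (g :+ b)) refl g′ old B ⟩
    old + (g′ + B)                      ≡⟨ cong (old +_) (balance links x y) ⟩
    old + (h + R)                       ≡⟨ solve 3 (λ g e b → e :+ (g :+ b) := g :+ (e :+ b)) refl h old R ⟩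
    h + (old + R)                       ≡⟨ cong (λ z → h + (z + R)) (sym (C-red x y)) ⟩
    h + (∥ C ∥ᶜ (δ red x y) + R)        ∎
    where
    open ≡-Reasoning
    g = 𝔟 (edge G x y)
    g′ = 𝔟 (edge G′ x y)
    h = 𝔟 (edge H x y)
    B = ∥ circuits ∥* (δ blue x y)
    R = ∥ circuits ∥* (δ red x y)
    old = 𝟙 ((x , y) ≈ᴱ? (a , c)) + 𝟙 ((x , y) ≈ᴱ? (b , d))
    new = 𝟙 ((x , y) ≈ᴱ? (b , c)) + 𝟙 ((x , y) ≈ᴱ? (a , d))

record Reduction {n : ℕ} (κ κ̄ : Colour) (G H : Graph n) (D : List (Circuit n)) : Set where
  field
    result  : List (Circuit n)
    reduced : Reduced result
    links   : Links κ κ̄ G H result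
    bound   : ∥ result ∥* one + 2 * length D ≤ ∥ D ∥* one + 2 * length result

reduce : Opp κ κ̄ → (D : List (Circuit n)) → Links κ κ̄ G H D → Reduction κ κ̄ G H D
reduce {κ = κ} {κ̄ = κ̄} {n = n} {G = G} {H = H} o D = <-rec P go (∥ D ∥* one) D refl
  where
  P : ℕ → Set
  P m = (D : List (Circuit n)) → ∥ D ∥* one ≡ m → Links κ κ̄ G H D → Reduction κ κ̄ G H D
  go : ∀ m → (∀ {m′} → m′ < m → P m′) → P m
  go m ih D refl links with reduced? D
  ... | inj₁ reduced = record { result = D ; reduced = reduced ; links = links ; bound = ≤-refl }
  ... | inj₂ (u , v , clash) = record
    { result = result ; reduced = reduced ; links = links′ ; bound = begin
        ∥ result ∥* one + 2 * length D                       ≤⟨ +-monoʳ-≤ (∥ result ∥* one) (*-monoʳ-≤ 2 count) ⟩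
        ∥ result ∥* one + 2 * suc (length remaining)         ≡⟨ solve 2 (λ a b → a :+ con 2 :* (con 1 :+ b) := con 2 :+ (a :+ con 2 :* b)) refl (∥ result ∥* one) (length remaining) ⟩
        2 + (∥ result ∥* one + 2 * length remaining)         ≤⟨ +-monoʳ-≤ 2 bound ⟩
        2 + (∥ remaining ∥* one + 2 * length result)         ≡⟨ cong (_+ 2 * length result) (sym (sums one)) ⟩
        ∥ D ∥* one + 2 * length result                       ∎ }
    where
    open ≤-Reasoning
    cancelled = cancel D u v clash
    open Cancelled cancelled
    open Reduction (ih (≤-trans (n≤1+n _) (≤-reflexive (sym (sums one)))) remaining refl (links-cancel o links cancelled))
      renaming (links to links′)

-- Multiplicities of undirected edges in lists

module _ {n : ℕ} where

  open SetoidMembership (edgeSetoid n) using (_∈_)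
  open SetoidDisjoint (edgeSetoid n) using (Disjoint)
  open SetoidUnique (edgeSetoid n) using () renaming (Unique to UniqueEdges)

  multiplicity : Fin n × Fin n → List (Fin n × Fin n) → ℕ
  multiplicity e []       = 0
  multiplicity e (f ∷ fs) = 𝟙 (e ≈ᴱ? f) + multiplicity e fs

  multiplicity-++ : ∀ e xs {ys} → multiplicity e (xs ++ ys) ≡ multiplicity e xs + multiplicity e ys
  multiplicity-++ e []       = refl
  multiplicity-++ e (f ∷ fs) = trans (cong (𝟙 (e ≈ᴱ? f) +_) (multiplicity-++ e fs)) (sym (+-assoc (𝟙 (e ≈ᴱ? f)) _ _))

  multiplicity⇒∈ : ∀ {e} xs → 1 ≤ multiplicity e xs → e ∈ xs
  multiplicity⇒∈ {e} (f ∷ fs) le with e ≈ᴱ? f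
  ... | yes e≈f = here e≈f
  ... | no _    = there (multiplicity⇒∈ fs le)

  ∈⇒multiplicity : ∀ {e xs} → e ∈ xs → 1 ≤ multiplicity e xs
  ∈⇒multiplicity {e} {f ∷ _} (here e≈f)  = m≤n⇒m≤n+o _ (≤-reflexive (sym (𝟙-yes (e ≈ᴱ? f) e≈f)))
  ∈⇒multiplicity {e} {f ∷ _} (there e∈) = m≤n⇒m≤o+n (𝟙 (e ≈ᴱ? f)) (∈⇒multiplicity e∈)

  unique⇒multiplicity≤1 : ∀ {xs} → UniqueEdges xs → ∀ e → multiplicity e xs ≤ 1
  unique⇒multiplicity≤1 [] e = z≤n
  unique⇒multiplicity≤1 {f ∷ fs} (f∉fs ∷ unique) e with e ≈ᴱ? f
  ... | no _    = unique⇒multiplicity≤1 unique e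
  ... | yes e≈f = s≤s (≤-reflexive (absent f∉fs))
    where
    absent : ∀ {gs} → All (f ≉ᴱ_) gs → multiplicity e gs ≡ 0
    absent []            = refl
    absent (f≉g ∷ f∉gs) = cong₂ _+_ (𝟙-no (e ≈ᴱ? _) (f≉g ∘ ≈ᴱ-trans (≈ᴱ-sym e≈f))) (absent f∉gs)

  multiplicity≤1⇒unique : ∀ xs → (∀ e → multiplicity e xs ≤ 1) → UniqueEdges xs
  multiplicity≤1⇒unique []       _  = []
  multiplicity≤1⇒unique (f ∷ fs) le =
    Allₚ.¬Any⇒All¬ fs (λ f∈fs → 1+n≰n (≤-trans (+-mono-≤ (≤-reflexive (sym (𝟙-yes (f ≈ᴱ? f) (inj₁ (refl , refl))))) (∈⇒multiplicity f∈fs)) (le f)))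
    ∷ multiplicity≤1⇒unique fs λ e → m+n≤o⇒n≤o (𝟙 (e ≈ᴱ? f)) (le e)

  multiplicity≤1⇒disjoint : ∀ xss → (∀ e → multiplicity e (concat xss) ≤ 1) → AllPairs Disjoint xss
  multiplicity≤1⇒disjoint []         _  = []
  multiplicity≤1⇒disjoint (xs ∷ xss) le =
    disjoint xss (λ e → subst (_≤ 1) (multiplicity-++ e xs) (le e))
    ∷ multiplicity≤1⇒disjoint xss λ e → m+n≤o⇒n≤o (multiplicity e xs) (subst (_≤ 1) (multiplicity-++ e xs) (le e))
    where
    disjoint : ∀ yss → (∀ e → multiplicity e xs + multiplicity e (concat yss) ≤ 1) → All (Disjoint xs) yss
    disjoint []         _  = []
    disjoint (ys ∷ yss) le =
      (λ {e} (e∈xs , e∈ys) → 1+n≰n (≤-trans (+-mono-≤ (∈⇒multiplicity e∈xs) (m≤n⇒m≤n+o _ (∈⇒multiplicity e∈ys))) (le′ e)))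
      ∷ disjoint yss λ e → ≤-trans (+-monoʳ-≤ (multiplicity e xs) (m≤n+m _ (multiplicity e ys))) (le′ e)
      where
      le′ : ∀ e → multiplicity e xs + (multiplicity e ys + multiplicity e (concat yss)) ≤ 1
      le′ e = subst (λ z → multiplicity e xs + z ≤ 1) (multiplicity-++ e ys) (le e)

  -- Applied to `edgeList` as well as to the concatenated circuits of a decomposition;
  -- `multiplicity-length` then equates the numbers of edges.
  multiplicity-indicator : ∀ (G : Graph n) {xs} → UniqueEdges xs → (∀ {u v} → Adj G u v → (u , v) ∈ xs) →
    All (λ e → Adj G (proj₁ e) (proj₂ e)) xs → ∀ u v → multiplicity (u , v) xs ≡ 𝔟 (edge G u v)
  multiplicity-indicator G {xs} unique covering edges u v with T? (edge G u v)
  ... | yes uv∈G = trans (≤-antisym (unique⇒multiplicity≤1 unique (u , v)) (∈⇒multiplicity (covering uv∈G))) (sym (𝔟-true uv∈G))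
  ... | no uv∉G  = trans (n<1⇒n≡0 (≰⇒> (uv∉G ∘ adjacent edges ∘ multiplicity⇒∈ xs))) (sym (𝔟-false uv∉G))
    where
    adjacent : ∀ {ys} → All (λ e → Adj G (proj₁ e) (proj₂ e)) ys → (u , v) ∈ ys → Adj G u v
    adjacent (a ∷ _)  (here uv≈f) = adj-resp G uv≈f a
    adjacent (_ ∷ as) (there uv∈) = adjacent as uv∈

  remove : ∀ {e xs} → e ∈ xs → ∃ λ ys → length xs ≡ suc (length ys) × (∀ f → multiplicity f xs ≡ 𝟙 (f ≈ᴱ? e) + multiplicity f ys)
  remove {e} {x ∷ xs} (here e≈x) = xs , refl , λ f →
    cong (_+ multiplicity f xs) (𝟙-cong (f ≈ᴱ? x) (f ≈ᴱ? e) (λ f≈x → ≈ᴱ-trans f≈x (≈ᴱ-sym e≈x)) (λ f≈e → ≈ᴱ-trans f≈e e≈x))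
  remove {e} {x ∷ xs} (there e∈xs) with ys , len , mult ← remove e∈xs = x ∷ ys , cong suc len , λ f →
    trans (cong (𝟙 (f ≈ᴱ? x) +_) (mult f))
      (solve 3 (λ a b c → a :+ (b :+ c) := b :+ (a :+ c)) refl (𝟙 (f ≈ᴱ? x)) (𝟙 (f ≈ᴱ? e)) (multiplicity f ys))

  -- One occurrence of the same undirected edge is struck from both lists at a time, so no canonical
  -- orientation or order is required.
  multiplicity-length : ∀ xs ys → (∀ e → multiplicity e xs ≡ multiplicity e ys) → length xs ≡ length ys
  multiplicity-length []       []       _  = refl
  multiplicity-length []       (y ∷ ys) eq =
    contradiction (≤-trans (∈⇒multiplicity {xs = y ∷ ys} (here (inj₁ (refl , refl)))) (≤-reflexive (sym (eq y)))) λ ()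
  multiplicity-length (x ∷ xs) ys       eq
    with zs , len , mult ← remove (multiplicity⇒∈ ys (≤-trans (∈⇒multiplicity {xs = x ∷ xs} (here (inj₁ (refl , refl)))) (≤-reflexive (eq x))))
    = trans (cong suc (multiplicity-length xs zs λ e → +-cancelˡ-≡ (𝟙 (e ≈ᴱ? x)) _ _ (trans (eq e) (mult e)))) (sym len)

  edgeList-adjacent : (G : Graph n) → All (λ e → Adj G (proj₁ e) (proj₂ e)) (edgeList G)
  edgeList-adjacent G = All.map proj₂ (Allₚ.all-filter _ (cartesianProduct (allFin n) (allFin n)))

  edgeList-ordered : (G : Graph n) → All (λ e → proj₁ e Fin.< proj₂ e) (edgeList G)
  edgeList-ordered G = All.map proj₁ (Allₚ.all-filter _ (cartesianProduct (allFin n) (allFin n)))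

  -- Two pairs listed in increasing order cannot be reverses of each other, so different pairs are
  -- different edges.
  edgeList-unique : (G : Graph n) → UniqueEdges (edgeList G)
  edgeList-unique G = ordered (edgeList-ordered G)
    (Uniqueₚ.filter⁺ _ (Uniqueₚ.cartesianProduct⁺ (Uniqueₚ.allFin⁺ n) (Uniqueₚ.allFin⁺ n)))
    where
    apart : ∀ {e : Fin n × Fin n} {fs} → proj₁ e Fin.< proj₂ e → All (λ f → proj₁ f Fin.< proj₂ f) fs →
            All (e ≢_) fs → All (e ≉ᴱ_) fs
    apart lt []         []           = []
    apart lt (lt′ ∷ lts) (e≢f ∷ e∉fs) =
      (λ { (inj₁ (refl , refl)) → e≢f refl ; (inj₂ (refl , refl)) → <-asym lt lt′ }) ∷ apart lt lts e∉fs
    ordered : ∀ {xs} → All (λ e → proj₁ e Fin.< proj₂ e) xs → Unique xs → UniqueEdges xs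
    ordered []         []             = []
    ordered (lt ∷ lts) (e∉fs ∷ unique) = apart lt lts e∉fs ∷ ordered lts unique

  edgeList-covering : (G : Graph n) → ∀ {u v} → Adj G u v → (u , v) ∈ edgeList G
  edgeList-covering G {u} {v} uv∈G with Finₚ.<-cmp u v
  ... | tri< u<v _ _    = Any.map (λ { refl → inj₁ (refl , refl) }) (Membershipₚ.∈-filter⁺ _ pair (u<v , uv∈G))
    where
    pair : (u , v) Membership.∈ cartesianProduct (allFin n) (allFin n)
    pair = Membershipₚ.∈-cartesianProduct⁺ (Membershipₚ.∈-allFin u) (Membershipₚ.∈-allFin v)
  ... | tri≈ _ refl _   = ⊥-elim (subst T (edge-irrefl G u) uv∈G)
  ... | tri> _ _ v<u    = Any.map (λ { refl → inj₂ (refl , refl) })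
                            (Membershipₚ.∈-filter⁺ _ pair (v<u , adj-resp G {v , u} {u , v} (inj₂ (refl , refl)) uv∈G))
    where
    pair : (v , u) Membership.∈ cartesianProduct (allFin n) (allFin n)
    pair = Membershipₚ.∈-cartesianProduct⁺ (Membershipₚ.∈-allFin v) (Membershipₚ.∈-allFin u)

  edgeList-multiplicity : (G : Graph n) → ∀ u v → multiplicity (u , v) (edgeList G) ≡ 𝔟 (edge G u v)
  edgeList-multiplicity G = multiplicity-indicator G (edgeList-unique G) (edgeList-covering G) (edgeList-adjacent G)

  edges : {s t : State n} → Path s t → List (Fin n × Fin n)
  edges nil                           = []
  edges (cons {u = u} {w = w} _ _ p) = (u , w) ∷ edges p

  edges* : List (Circuit n) → List (List (Fin n × Fin n))
  edges* = map (λ C → edges (closed C))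

  either-colour : ∀ κ k → k ≡ matching red κ k + matching blue κ k
  either-colour red  k = sym (+-identityʳ k)
  either-colour blue k = refl

  edges-multiplicity : ∀ u v {s t : State n} (p : Path s t) →
    multiplicity (u , v) (edges p) ≡ ∥ p ∥ (δ red u v) + ∥ p ∥ (δ blue u v)
  edges-multiplicity u v nil = refl
  edges-multiplicity u v (cons {κ = κ} {u = x} {w = y} _ _ p) = trans
    (cong₂ _+_ (either-colour κ (𝟙 ((u , v) ≈ᴱ? (x , y)))) (edges-multiplicity u v p))
    (solve 4 (λ a b c d → (a :+ b) :+ (c :+ d) := (a :+ c) :+ (b :+ d)) refl
      (weight (δ red u v) κ x y) (weight (δ blue u v) κ x y) (∥ p ∥ (δ red u v)) (∥ p ∥ (δ blue u v)))

  edges*-multiplicity : ∀ u v (D : List (Circuit n)) →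
    multiplicity (u , v) (concat (edges* D)) ≡ ∥ D ∥* (δ red u v) + ∥ D ∥* (δ blue u v)
  edges*-multiplicity u v []      = refl
  edges*-multiplicity u v (C ∷ D) = trans (multiplicity-++ (u , v) (edges (closed C)))
    (trans (cong₂ _+_ (edges-multiplicity u v (closed C)) (edges*-multiplicity u v D))
      (solve 4 (λ a b c d → (a :+ b) :+ (c :+ d) := (a :+ c) :+ (b :+ d)) refl
        (∥ C ∥ᶜ (δ red u v)) (∥ C ∥ᶜ (δ blue u v)) (∥ D ∥* (δ red u v)) (∥ D ∥* (δ blue u v))))

  edges-length : {s t : State n} (p : Path s t) → length (edges p) ≡ ∥ p ∥ one
  edges-length nil          = refl
  edges-length (cons _ _ p) = cong suc (edges-length p)

  edges*-length : (D : List (Circuit n)) → length (concat (edges* D)) ≡ ∥ D ∥* one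
  edges*-length []      = refl
  edges*-length (C ∷ D) = trans (length-++ (edges (closed C))) (cong₂ _+_ (edges-length (closed C)) (edges*-length D))

-- Circuits and decompositions

opp-from-≢ : κ ≢ κ̄ → Opp κ κ̄
opp-from-≢ {red}  {red}  κ≢κ̄ = contradiction refl κ≢κ̄
opp-from-≢ {red}  {blue} _   = rb
opp-from-≢ {blue} {red}  _   = br
opp-from-≢ {blue} {blue} κ≢κ̄ = contradiction refl κ≢κ̄

opp-≢ : Opp κ κ̄ → κ ≢ κ̄
opp-≢ rb ()
opp-≢ br ()

matching-+ : ∀ κ ι {a b} → matching κ ι (a + b) ≡ matching κ ι a + matching κ ι b
matching-+ red  red  = refl
matching-+ red  blue = refl
matching-+ blue red  = refl
matching-+ blue blue = refl

matching-0 : ∀ κ ι → matching κ ι 0 ≡ 0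
matching-0 red  red  = refl
matching-0 red  blue = refl
matching-0 blue red  = refl
matching-0 blue blue = refl

-- The colour due at the start of a walk. The default `ι` is the colour due after its end, which for
-- a closed walk is its first colour again.
first-colour : List Colour → Colour → Colour
first-colour []       ι = ι
first-colour (κ ∷ _) ι = κ

linked-cons : ∀ {κ ι} ks → κ ≢ first-colour ks ι → Linked _≢_ (ks ++ [ ι ]) → Linked _≢_ (κ ∷ ks ++ [ ι ])
linked-cons []      κ≢ lk = κ≢ ∷ lk
linked-cons (_ ∷ _) κ≢ lk = κ≢ ∷ lk

linked-uncons : ∀ {κ ι} ks → Linked _≢_ (κ ∷ ks ++ [ ι ]) → κ ≢ first-colour ks ι × Linked _≢_ (ks ++ [ ι ])
linked-uncons []      (κ≢ ∷ lk) = κ≢ , lk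
linked-uncons (_ ∷ _) (κ≢ ∷ lk) = κ≢ , lk

module Conversion {n : ℕ} (G H : Graph n) where

  open SetoidMembership (edgeSetoid n) using (_∈_)
  open SetoidDisjoint (edgeSetoid n) using (Disjoint)
  open SetoidUnique (edgeSetoid n) using () renaming (Unique to UniqueEdges)

  R : RedBlueGraph n
  R = redBlue G H

  edge-colour : Fin n → Fin n → Colour
  edge-colour u v = if edge G u v then red else blue

  edge-colour-resp : ∀ {u v x y} → (u , v) ≈ᴱ (x , y) → edge-colour x y ≡ edge-colour u v
  edge-colour-resp (inj₁ (refl , refl)) = refl
  edge-colour-resp (inj₂ (refl , refl)) = cong (if_then red else blue) (edge-sym G _ _)

  adjacent-distinct : ∀ {u w} → Adj (G △ H) u w → u ≢ w
  adjacent-distinct {u} uw refl = subst T (edge-irrefl (G △ H) u) uw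

  toPath : ∀ {u v} (p : Walk R u v) ι → Linked _≢_ (walkColours R p ++ [ ι ]) →
           Path (first-colour (walkColours R p) ι , u) (ι , v)
  toPath nil ι _ = nil
  toPath {u} (cons w uw p) ι lk = cons (opp-from-≢ (proj₁ (linked-uncons (walkColours R p) lk)))
                                       (adjacent-distinct uw)
                                       (toPath p ι (proj₂ (linked-uncons (walkColours R p) lk)))

  toPath-edges : ∀ {u v} (p : Walk R u v) ι lk → edges (toPath p ι lk) ≡ walkEdges R p
  toPath-edges nil ι lk = refl
  toPath-edges {u} (cons w uw p) ι lk = cong ((u , w) ∷_) (toPath-edges p ι _)

  -- The colour of an edge depends only on the unordered pair, so all occurrences of `xy` have
  -- colour `edge-colour x y`.
  toPath-count : ∀ κ x y {u v} (p : Walk R u v) ι lk →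
    ∥ toPath p ι lk ∥ (δ κ x y) ≡ matching κ (edge-colour x y) (multiplicity (x , y) (walkEdges R p))
  toPath-count κ x y nil ι lk = sym (matching-0 κ (edge-colour x y))
  toPath-count κ x y {u} (cons w uw p) ι lk = trans
    (cong₂ _+_ (recolour ((x , y) ≈ᴱ? (u , w))) (toPath-count κ x y p ι _))
    (sym (matching-+ κ (edge-colour x y) {𝟙 ((x , y) ≈ᴱ? (u , w))}))
    where
    recolour : (d : Dec ((x , y) ≈ᴱ (u , w))) → matching κ (edge-colour u w) (𝟙 d) ≡ matching κ (edge-colour x y) (𝟙 d)
    recolour (yes xy≈uw) = cong (λ ι → matching κ ι 1) (edge-colour-resp xy≈uw)
    recolour (no _)      = trans (matching-0 κ (edge-colour u w)) (sym (matching-0 κ (edge-colour x y)))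

  record Converted (C : AlternatingCircuit R) : Set where
    field
      alternatingWalk : Circuit n
      same-edges : edges (closed alternatingWalk) ≡ circuitEdges R C
      counts     : ∀ κ x y → ∥ alternatingWalk ∥ᶜ (δ κ x y) ≡ matching κ (edge-colour x y) (multiplicity (x , y) (circuitEdges R C))

  toCircuit : (C : AlternatingCircuit R) → Converted C
  toCircuit record { walk = nil ; nonEmpty = nonEmpty } = contradiction refl nonEmpty
  toCircuit record { start = u ; walk = p@(cons w uw p′) ; alternating = lk } = record
    { alternatingWalk = circuit (opp-from-≢ (proj₁ (linked-uncons (walkColours R p′) lk))) (adjacent-distinct uw)
                                (toPath p′ (edge-colour u w) (proj₂ (linked-uncons (walkColours R p′) lk)))
    ; same-edges = toPath-edges p (edge-colour u w) lk
    ; counts     = λ κ x y → toPath-count κ x y p (edge-colour u w) lk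
    }

  record ConvertedList (Cs : List (AlternatingCircuit R)) : Set where
    field
      alternatingWalks : List (Circuit n)
      number     : length alternatingWalks ≡ length Cs
      same-edges : edges* alternatingWalks ≡ map (circuitEdges R) Cs
      counts     : ∀ κ x y → ∥ alternatingWalks ∥* (δ κ x y) ≡
                     matching κ (edge-colour x y) (multiplicity (x , y) (concat (map (circuitEdges R) Cs)))

  toCircuits : (Cs : List (AlternatingCircuit R)) → ConvertedList Cs
  toCircuits [] = record { alternatingWalks = [] ; number = refl ; same-edges = refl
                         ; counts = λ κ x y → sym (matching-0 κ (edge-colour x y)) }
  toCircuits (C ∷ Cs) = record
    { alternatingWalks = alternatingWalk ∷ alternatingWalks
    ; number     = cong suc number
    ; same-edges = cong₂ _∷_ same-edges same-edges*
    ; counts     = λ κ x y → trans (cong₂ _+_ (counts κ x y) (counts* κ x y))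
        (trans (sym (matching-+ κ (edge-colour x y) {multiplicity (x , y) (circuitEdges R C)}))
          (cong (matching κ (edge-colour x y)) (sym (multiplicity-++ (x , y) (circuitEdges R C)))))
    }
    where
    open Converted (toCircuit C)
    open ConvertedList (toCircuits Cs) renaming (same-edges to same-edges*; counts to counts*)

  walk-adjacent : ∀ {u v} (p : Walk R u v) → All (λ e → Adj (G △ H) (proj₁ e) (proj₂ e)) (walkEdges R p)
  walk-adjacent nil           = []
  walk-adjacent (cons w uw p) = uw ∷ walk-adjacent p

  module _ (X : Decomposition R) where

    open Decomposition X

    private
      all-edges : List (Fin n × Fin n)
      all-edges = concat (map (circuitEdges R) circuits)

      all-edges-multiplicity : ∀ u v → multiplicity (u , v) all-edges ≡ 𝔟 (edge (G △ H) u v)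
      all-edges-multiplicity = multiplicity-indicator (G △ H)
        (SetoidUniqueₚ.concat⁺ (edgeSetoid n)
          (Allₚ.map⁺ (All.universal AlternatingCircuit.trail circuits)) (AllPairsₚ.map⁺ disjoint))
        (λ {u} {v} uv → SetoidMembershipₚ.∈-concat⁺ (edgeSetoid n) (Anyₚ.map⁺ (covering u v uv)))
        (Allₚ.concat⁺ (Allₚ.map⁺ (All.universal (λ C → walk-adjacent (AlternatingCircuit.walk C)) circuits)))

      open ConvertedList (toCircuits circuits)

    decomposition⇒circuits : ∃ λ D → Links red blue G H D × length D ≡ size R X × ∥ D ∥* one ≡ ∣E∣ (G △ H)
    decomposition⇒circuits = alternatingWalks , linking bal , number , (begin
      ∥ alternatingWalks ∥* one                ≡⟨ sym (edges*-length alternatingWalks) ⟩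
      length (concat (edges* alternatingWalks)) ≡⟨ cong (length ∘ concat) same-edges ⟩
      length all-edges                         ≡⟨ multiplicity-length all-edges (edgeList (G △ H))
                                                    (λ (u , v) → trans (all-edges-multiplicity u v) (sym (edgeList-multiplicity (G △ H) u v))) ⟩
      ∣E∣ (G △ H)                              ∎)
      where
      open ≡-Reasoning
      bal : ∀ u v → 𝔟 (edge G u v) + ∥ alternatingWalks ∥* (δ blue u v) ≡ 𝔟 (edge H u v) + ∥ alternatingWalks ∥* (δ red u v)
      bal u v rewrite counts blue u v | counts red u v | all-edges-multiplicity u v = by-cases (edge G u v) (edge H u v)
        where
        by-cases : ∀ g h → 𝔟 g + matching blue (if g then red else blue) (𝔟 (g xor h)) ≡
                           𝔟 h + matching red  (if g then red else blue) (𝔟 (g xor h))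
        by-cases false false = refl
        by-cases false true  = refl
        by-cases true  false = refl
        by-cases true  true  = refl

  module _ {D : List (Circuit n)} (links : Links red blue G H D) (reduced : Reduced D) where

    private
      xor-adjacentˡ : ∀ {a b} → T a → ¬ T b → T (a xor b)
      xor-adjacentˡ {true} {false} _ _  = tt
      xor-adjacentˡ {true} {true}  _ ¬b = ¬b tt
      xor-adjacentʳ : ∀ {a b} → T b → ¬ T a → T (a xor b)
      xor-adjacentʳ {false} b _  = b
      xor-adjacentʳ {true}  _ ¬a = ⊥-elim (¬a tt)
      red-if : ∀ {a} → T a → (if a then red else blue) ≡ red
      red-if {true} _ = refl
      blue-if : ∀ {a} → ¬ T a → (if a then red else blue) ≡ blue
      blue-if {true}  ¬a = ⊥-elim (¬a tt)
      blue-if {false} _  = refl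

    -- Stated for an arbitrary sum over weights so that it passes from a family to its circuits and
    -- from a path to its tails.
    Faithful : (Weight n → ℕ) → Set
    Faithful W = ∀ κ u v → 1 ≤ W (δ κ u v) → Adj (G △ H) u v × edge-colour u v ≡ κ

    faithful : Faithful ∥ D ∥*
    faithful red  u v le with uv∈G , uv∉H ← edge-of-colour u v rb links reduced le =
      xor-adjacentˡ uv∈G uv∉H , red-if uv∈G
    faithful blue u v le with uv∈H , uv∉G ← edge-of-colour u v br (links-sym links) reduced le =
      xor-adjacentʳ uv∈H uv∉G , blue-if uv∉G

    head-edge : ∀ {u w t} (o : Opp κ κ̄) (d : u ≢ w) (p : Path (κ̄ , w) t) → Faithful ∥ cons o d p ∥ →
                Adj (G △ H) u w × edge-colour u w ≡ κ
    head-edge {κ = κ} {u = u} {w = w} _ _ _ f = f κ u w (m≤n⇒m≤n+o _ (δ-positive κ u w))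

    tail : ∀ {u w t} (o : Opp κ κ̄) (d : u ≢ w) (p : Path (κ̄ , w) t) → Faithful ∥ cons o d p ∥ → Faithful ∥ p ∥
    tail {κ = κ} {u = u} {w = w} _ _ _ f ι x y le = f ι x y (m≤n⇒m≤o+n (weight (δ ι x y) κ u w) le)

    fromPath : ∀ {u v} (p : Path (κ , u) (ι , v)) → Faithful ∥ p ∥ → Walk R u v
    fromPath nil          f = nil
    fromPath (cons {w = w} o d p) f = cons w (proj₁ (head-edge o d p f)) (fromPath p (tail o d p f))

    fromPath-edges : ∀ {u v} (p : Path (κ , u) (ι , v)) (f : Faithful ∥ p ∥) → walkEdges R (fromPath p f) ≡ edges p
    fromPath-edges nil          f = refl
    fromPath-edges (cons o d p) f = cong (_ ∷_) (fromPath-edges p (tail o d p f))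

    fromPath-first : ∀ {u v} (p : Path (κ , u) (ι , v)) (f : Faithful ∥ p ∥) →
                     first-colour (walkColours R (fromPath p f)) ι ≡ κ
    fromPath-first nil          f = refl
    fromPath-first (cons o d p) f = proj₂ (head-edge o d p f)

    fromPath-alternates : ∀ {u v} (p : Path (κ , u) (ι , v)) (f : Faithful ∥ p ∥) →
                          Linked _≢_ (walkColours R (fromPath p f) ++ [ ι ])
    fromPath-alternates nil          f = [-]
    fromPath-alternates (cons o d p) f = linked-cons (walkColours R (fromPath p (tail o d p f)))
      (λ eq → opp-≢ o (trans (sym (proj₂ (head-edge o d p f))) (trans eq (fromPath-first p (tail o d p f)))))
      (fromPath-alternates p (tail o d p f))

    fromCircuit : (C : Circuit n) → Faithful ∥ C ∥ᶜ → UniqueEdges (edges (closed C)) →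
                  ∃ λ (A : AlternatingCircuit R) → circuitEdges R A ≡ edges (closed C)
    fromCircuit C@(circuit {κ} o d p) f unique = record
      { walk        = fromPath (closed C) f
      ; nonEmpty    = λ ()
      ; trail       = subst UniqueEdges (sym same) unique
      ; alternating = subst (λ ι → Linked _≢_ (walkColours R (fromPath (closed C) f) ++ [ ι ]))
                            (sym (proj₂ (head-edge o d p f))) (fromPath-alternates (closed C) f)
      } , same
      where
      same : walkEdges R (fromPath (closed C) f) ≡ edges (closed C)
      same = fromPath-edges (closed C) f

    fromCircuits : (E : List (Circuit n)) → Faithful ∥ E ∥* → UniqueEdges (concat (edges* E)) →
                   ∃ λ (As : List (AlternatingCircuit R)) → map (circuitEdges R) As ≡ edges* E
    fromCircuits []      f unique = [] , refl
    fromCircuits (C ∷ E) f unique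
      with A , eq ← fromCircuit C (λ κ u v le → f κ u v (m≤n⇒m≤n+o _ le))
                      (multiplicity≤1⇒unique _ λ e → m+n≤o⇒m≤o (multiplicity e (edges (closed C)))
                        (subst (_≤ 1) (multiplicity-++ e (edges (closed C))) (unique⇒multiplicity≤1 unique e)))
         | As , eqs ← fromCircuits E (λ κ u v le → f κ u v (m≤n⇒m≤o+n (∥ C ∥ᶜ (δ κ u v)) le))
                      (multiplicity≤1⇒unique _ λ e → m+n≤o⇒n≤o (multiplicity e (edges (closed C)))
                        (subst (_≤ 1) (multiplicity-++ e (edges (closed C))) (unique⇒multiplicity≤1 unique e)))
      = A ∷ As , cong₂ _∷_ eq eqs

    -- With one colour absent, the balance makes the other colour occur as often as the two
    -- indicators differ, and this is their exclusive or.
    reduced-multiplicity : ∀ u v → multiplicity (u , v) (concat (edges* D)) ≡ 𝔟 (edge (G △ H) u v)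
    reduced-multiplicity u v = trans (edges*-multiplicity u v D)
      (by-cases (edge G u v) (edge H u v) _ _ (reduced u v) (balance links u v))
      where
      by-cases : ∀ g h r b → ¬ (1 ≤ r × 1 ≤ b) → 𝔟 g + b ≡ 𝔟 h + r → r + b ≡ 𝔟 (g xor h)
      by-cases g     h     (suc r) (suc b) ¬rb eq = ⊥-elim (¬rb (s≤s z≤n , s≤s z≤n))
      by-cases false false zero    b       _   eq = eq
      by-cases false true  zero    b       _   eq = eq
      by-cases true  true  zero    b       _   eq = suc-injective eq
      by-cases false false (suc r) zero    _   ()
      by-cases false true  (suc r) zero    _   ()
      by-cases true  false (suc r) zero    _   eq = trans (+-identityʳ _) (sym eq)
      by-cases true  true  (suc r) zero    _   ()

    circuits⇒decomposition : ∃ λ (X : Decomposition R) → size R X ≡ length D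
    circuits⇒decomposition = record
      { circuits = As
      ; disjoint = AllPairsₚ.map⁻ (subst (AllPairs Disjoint) (sym eq)
                     (multiplicity≤1⇒disjoint (edges* D) (unique⇒multiplicity≤1 unique)))
      ; covering = λ u v uv → Anyₚ.map⁻ (subst (Any ((u , v) ∈_)) (sym eq)
                     (SetoidMembershipₚ.∈-concat⁻ (edgeSetoid n) (edges* D)
                       (multiplicity⇒∈ _ (≤-reflexive (sym (trans (reduced-multiplicity u v) (𝔟-true uv)))))))
      } , trans (sym (length-map (circuitEdges R) As)) (trans (cong length eq) (length-map _ D))
      where
      unique : UniqueEdges (concat (edges* D))
      unique = multiplicity≤1⇒unique _ λ (u , v) → ≤-trans (≤-reflexive (reduced-multiplicity u v)) (𝔟≤1 (edge (G △ H) u v))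
        where
        𝔟≤1 : ∀ b → 𝔟 b ≤ 1
        𝔟≤1 true  = ≤-refl
        𝔟≤1 false = z≤n
      As = proj₁ (fromCircuits D faithful unique)
      eq : map (circuitEdges R) As ≡ edges* D
      eq = proj₂ (fromCircuits D faithful unique)

    reduced-size : ∥ D ∥* one ≡ ∣E∣ (G △ H)
    reduced-size = trans (sym (edges*-length D)) (multiplicity-length (concat (edges* D)) (edgeList (G △ H))
      λ (u , v) → trans (reduced-multiplicity u v) (sym (edgeList-multiplicity (G △ H) u v)))

-- Existence of linking circuits

record Piece (n : ℕ) : Set where
  constructor piece
  field
    {start end} : State n
    path        : Path start end

open Piece

∥_∥ᵖ : List (Piece n) → Weight n → ℕ
∥ [] ∥ᵖ     f = 0
∥ P ∷ Ps ∥ᵖ f = ∥ path P ∥ f + ∥ Ps ∥ᵖ f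

∥++∥ᵖ : (Ps Qs : List (Piece n)) → ∀ f → ∥ Ps ++ Qs ∥ᵖ f ≡ ∥ Ps ∥ᵖ f + ∥ Qs ∥ᵖ f
∥++∥ᵖ []       Qs f = refl
∥++∥ᵖ (P ∷ Ps) Qs f = trans (cong (∥ path P ∥ f +_) (∥++∥ᵖ Ps Qs f)) (sym (+-assoc (∥ path P ∥ f) _ _))

at : Colour → Fin n → State n → ℕ
at κ x (ι , u) = matching κ ι (𝟙 (x ≟ u))

at-opp : Opp κ κ̄ → Opp ι ῑ → ∀ (x u : Fin n) → at κ̄ x (ῑ , u) ≡ at κ x (ι , u)
at-opp rb rb x u = refl
at-opp rb br x u = refl
at-opp br rb x u = refl
at-opp br br x u = refl

at-self : ∀ κ (x : Fin n) → at κ x (κ , x) ≡ 1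
at-self κ x = trans (matching-same κ) (𝟙-yes (x ≟ x) refl)

at-positive : ∀ κ (x : Fin n) s → 1 ≤ at κ x s → s ≡ (κ , x)
at-positive κ x (ι , u) le with refl , le′ ← matching-positive κ ι le | refl ← 𝟙-true (x ≟ u) (proj₂ (matching-positive κ ι le)) = refl

-- A piece that ends in state (κ̄ , x) arrives at x by an edge of colour κ.
ends : Colour → Colour → Fin n → List (Piece n) → ℕ
ends κ κ̄ x []       = 0
ends κ κ̄ x (P ∷ Ps) = (at κ x (start P) + at κ̄ x (end P)) + ends κ κ̄ x Ps

ends-++ : ∀ κ κ̄ (x : Fin n) Ps {Qs} → ends κ κ̄ x (Ps ++ Qs) ≡ ends κ κ̄ x Ps + ends κ κ̄ x Qs
ends-++ κ κ̄ x []       = refl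
ends-++ κ κ̄ x (P ∷ Ps) = trans (cong (at κ x (start P) + at κ̄ x (end P) +_) (ends-++ κ κ̄ x Ps))
                               (sym (+-assoc (at κ x (start P) + at κ̄ x (end P)) _ _))

Balanced : List (Piece n) → Set
Balanced {n} Ps = ∀ (x : Fin n) → ends red blue x Ps ≡ ends blue red x Ps

record Continuation {n : ℕ} (s : State n) (Ps : List (Piece n)) : Set where
  field
    {target} : State n
    next     : Path s target
    others   : List (Piece n)
    count    : length Ps ≡ suc (length others)
    sums     : ∀ f → ∥ Ps ∥ᵖ f ≡ ∥ next ∥ f + ∥ others ∥ᵖ f
    ends-sum : ∀ {κ κ̄} → Opp κ κ̄ → ∀ x → ends κ κ̄ x Ps ≡ (at κ x s + at κ̄ x target) + ends κ κ̄ x others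

opposite : ∀ κ → ∃ (Opp κ)
opposite red  = blue , rb
opposite blue = red , br

-- The end found at `x` may be the start or the finish of a piece; in the second case the piece is
-- reversed, which `ends-sum` shows to leave the numbers of ends unchanged.
continue : Opp κ κ̄ → ∀ (x : Fin n) Ps → 1 ≤ ends κ κ̄ x Ps → Continuation (κ , x) Ps
continue {κ = κ} {κ̄ = κ̄} o x (P@(piece {s} {t} p) ∷ Ps) le with 1≤+ (at κ x s + at κ̄ x t) le
... | inj₂ in-rest = record
  { next = next ; others = P ∷ others ; count = cong suc count
  ; sums = λ f → trans (cong (∥ p ∥ f +_) (sums f))
      (solve 3 (λ a b c → a :+ (b :+ c) := b :+ (a :+ c)) refl (∥ p ∥ f) (∥ next ∥ f) (∥ others ∥ᵖ f))
  ; ends-sum = λ {ι} {ῑ} o₁ y → trans (cong ((at ι y s + at ῑ y t) +_) (ends-sum o₁ y))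
      (solve 3 (λ a b c → a :+ (b :+ c) := b :+ (a :+ c)) refl (at ι y s + at ῑ y t) (at ι y (κ , x) + at ῑ y target) (ends ι ῑ y others))
  }
  where open Continuation (continue o x Ps in-rest)
... | inj₁ in-first with 1≤+ (at κ x s) in-first
...   | inj₁ starts with refl ← at-positive κ x s starts = record
  { next = p ; others = Ps ; count = refl ; sums = λ _ → refl ; ends-sum = λ _ _ → refl }
...   | inj₂ finishes with refl ← at-positive κ̄ x t finishes = record
  { next = rev o′ (opp-sym o) p ; others = Ps ; count = refl
  ; sums = λ f → cong (_+ ∥ Ps ∥ᵖ f) (sym (∥rev∥ o′ (opp-sym o) p f))
  ; ends-sum = λ {ι} {ῑ} o₁ y → cong (_+ ends ι ῑ y Ps)
      (trans (+-comm (at ι y s) _) (cong₂ _+_ (at-opp o₁ o y x) (sym (at-opp o₁ o′ y (proj₂ s)))))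
  }
  where o′ = proj₂ (opposite (proj₁ s))

_≟ᶜ_ : (κ ι : Colour) → Dec (κ ≡ ι)
red  ≟ᶜ red  = yes refl
red  ≟ᶜ blue = no λ ()
blue ≟ᶜ red  = no λ ()
blue ≟ᶜ blue = yes refl

_≟ˢ_ : (s t : State n) → Dec (s ≡ t)
(κ , u) ≟ˢ (ι , v) = map′ (λ { (refl , refl) → refl }) (λ { refl → refl , refl }) ((κ ≟ᶜ ι) ×-dec (u ≟ v))

balanced-opp : {Ps : List (Piece n)} → Balanced Ps → Opp κ κ̄ → ∀ x → ends κ κ̄ x Ps ≡ ends κ̄ κ x Ps
balanced-opp balanced rb x = balanced x
balanced-opp balanced br x = sym (balanced x)

-- The first piece is extended until it closes. If it stops in `(κ , x)`, it has an end of the other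
-- colour there, so by balance some end of colour `κ` is at `x`; that end is not its own start,
-- since the piece is not closed. Gluing removes one red and one blue end at `x`, which keeps the
-- balance.
join : ∀ m (Ps : List (Piece n)) → length Ps ≤ m → Balanced Ps → ∃ λ D → ∀ f → ∥ D ∥* f ≡ ∥ Ps ∥ᵖ f
join m [] le balanced = [] , λ _ → refl
join (suc m) (piece {s} {t@(κ , x)} p ∷ Ps) (s≤s le) balanced with s ≟ˢ t
... | yes refl = close p ++ proj₁ joined , λ f →
      trans (∥++∥ (close p) (proj₁ joined) f) (cong₂ _+_ (∥close∥ p f) (proj₂ joined f))
  where
  balanced′ : Balanced Ps
  balanced′ y = +-cancelˡ-≡ (at red y s + at blue y s) _ _
    (trans (balanced y) (cong (_+ ends blue red y Ps) (+-comm (at blue y s) (at red y s))))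
  joined = join m Ps le balanced′
... | no s≢t = proj₁ joined , λ f → trans (proj₂ joined f)
        (trans (cong (_+ ∥ others ∥ᵖ f) (∥⟫∥ p next f)) (trans (+-assoc (∥ p ∥ f) _ _) (cong (∥ p ∥ f +_) (sym (sums f)))))
  where
  κ′ = proj₁ (opposite κ)
  o = proj₂ (opposite κ)
  available : 1 ≤ ends κ κ′ x Ps
  available = begin
    1                                                       ≡⟨ sym (at-self κ x) ⟩
    at κ x t                                                ≤⟨ m≤n+m _ (at κ′ x s) ⟩
    at κ′ x s + at κ x t                                     ≤⟨ m≤m+n _ _ ⟩
    (at κ′ x s + at κ x t) + ends κ′ κ x Ps                   ≡⟨ sym (balanced-opp {Ps = piece p ∷ Ps} balanced o x) ⟩
    (at κ x s + at κ′ x t) + ends κ κ′ x Ps                   ≡⟨ cong (_+ ends κ κ′ x Ps) (cong₂ _+_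
                                                                (n<1⇒n≡0 (≰⇒> (s≢t ∘ at-positive κ x s))) (matching-opp (opp-sym o))) ⟩
    ends κ κ′ x Ps                                           ∎
    where open ≤-Reasoning
  open Continuation (continue o x Ps available)
  le′ : suc (length others) ≤ m
  le′ = subst (_≤ m) count le
  balanced′ : Balanced (piece (p ⟫ next) ∷ others)
  balanced′ y = +-cancelˡ-≡ (at red y t + at blue y t) _ _ (begin
    (at red y t + at blue y t) + ((at red y s + at blue y target) + A)
      ≡⟨ solve 5 (λ r b s e a → (r :+ b) :+ ((s :+ e) :+ a) := (s :+ b) :+ ((r :+ e) :+ a)) refl (at red y t) (at blue y t) (at red y s) (at blue y target) A ⟩
    (at red y s + at blue y t) + ((at red y t + at blue y target) + A)
      ≡⟨ cong ((at red y s + at blue y t) +_) (sym (ends-sum rb y)) ⟩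
    (at red y s + at blue y t) + ends red blue y Ps
      ≡⟨ balanced y ⟩
    (at blue y s + at red y t) + ends blue red y Ps
      ≡⟨ cong ((at blue y s + at red y t) +_) (ends-sum br y) ⟩
    (at blue y s + at red y t) + ((at blue y t + at red y target) + B)
      ≡⟨ solve 5 (λ r b s e a → (s :+ r) :+ ((b :+ e) :+ a) := (r :+ b) :+ ((s :+ e) :+ a)) refl (at red y t) (at blue y t) (at blue y s) (at red y target) B ⟩
    (at red y t + at blue y t) + ((at blue y s + at red y target) + B) ∎)
    where
    open ≡-Reasoning
    A = ends red blue y others
    B = ends blue red y others
  joined = join m (piece (p ⟫ next) ∷ others) le′ balanced′

NonLoop : Fin n × Fin n → Set
NonLoop (u , v) = u ≢ v

edge-pieces : Opp κ κ̄ → {es : List (Fin n × Fin n)} → All NonLoop es → List (Piece n)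
edge-pieces o []                      = []
edge-pieces o {(u , v) ∷ _} (u≢v ∷ ds) = piece (edge⟨ o , u≢v ⟩) ∷ edge-pieces o ds

edge-pieces-count : ∀ ι (o : Opp κ κ̄) x y {es : List (Fin n × Fin n)} (ds : All NonLoop es) →
  ∥ edge-pieces o ds ∥ᵖ (δ ι x y) ≡ matching ι κ (multiplicity (x , y) es)
edge-pieces-count {κ = κ} ι o x y [] = sym (matching-0 ι κ)
edge-pieces-count {κ = κ} ι o x y {(u , v) ∷ es} (_ ∷ ds) = trans
  (cong₂ _+_ (+-identityʳ (weight (δ ι x y) κ u v)) (edge-pieces-count ι o x y ds))
  (sym (matching-+ ι κ {𝟙 ((x , y) ≈ᴱ? (u , v))}))

incidences : Fin n → List (Fin n × Fin n) → ℕ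
incidences x []             = 0
incidences x ((u , v) ∷ es) = (𝟙 (x ≟ u) + 𝟙 (x ≟ v)) + incidences x es

edge-pieces-ends : ∀ (o : Opp κ κ̄) x {es : List (Fin n × Fin n)} (ds : All NonLoop es) →
  ends κ κ̄ x (edge-pieces o ds) ≡ incidences x es
edge-pieces-ends o x [] = refl
edge-pieces-ends {κ = κ} {κ̄ = κ̄} o x (_ ∷ ds) =
  cong₂ _+_ (cong₂ _+_ (matching-same κ) (matching-same κ̄)) (edge-pieces-ends o x ds)

edge-pieces-no-ends : ∀ (o : Opp κ κ̄) x {es : List (Fin n × Fin n)} (ds : All NonLoop es) →
  ends κ̄ κ x (edge-pieces o ds) ≡ 0
edge-pieces-no-ends o x [] = refl
edge-pieces-no-ends o x (_ ∷ ds) =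
  cong₂ _+_ (cong₂ _+_ (matching-opp (opp-sym o)) (matching-opp o)) (edge-pieces-no-ends o x ds)

sum-indicator : ∀ (v : Fin n) → sum (λ w → 𝟙 (v ≟ w)) ≡ 1
sum-indicator {suc n} zero    = cong suc (sum-replicate-zero n)
sum-indicator {suc n} (suc v) = sum-indicator v

incidences-of-edge : ∀ (x u v : Fin n) → u ≢ v → 𝟙 (x ≟ u) + 𝟙 (x ≟ v) ≡ sum (λ w → 𝟙 ((x , w) ≈ᴱ? (u , v)))
incidences-of-edge {n} x u v u≢v with x ≟ u | x ≟ v
... | yes refl | yes refl = contradiction refl u≢v
... | yes refl | no x≢v   = sym (trans (sum-cong-≗ λ w → 𝟙-cong ((x , w) ≈ᴱ? (x , v)) (v ≟ w)
                              (λ { (inj₁ (_ , w≡v)) → sym w≡v ; (inj₂ (x≡v , _)) → contradiction x≡v x≢v })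
                              (λ { refl → inj₁ (refl , refl) })) (sum-indicator v))
... | no x≢u   | yes refl = sym (trans (sum-cong-≗ λ w → 𝟙-cong ((x , w) ≈ᴱ? (u , x)) (u ≟ w)
                              (λ { (inj₁ (x≡u , _)) → contradiction x≡u x≢u ; (inj₂ (_ , w≡u)) → sym w≡u })
                              (λ { refl → inj₂ (refl , refl) })) (sum-indicator u))
... | no x≢u   | no x≢v   = sym (trans (sum-cong-≗ λ w → 𝟙-no ((x , w) ≈ᴱ? (u , v))
                              λ { (inj₁ (x≡u , _)) → x≢u x≡u ; (inj₂ (x≡v , _)) → x≢v x≡v }) (sum-replicate-zero n))

-- An edge at `x` that is no loop has exactly one other end `w`, so its incidences can be counted by
-- `w`.
incidences-sum : ∀ (x : Fin n) {es} → All NonLoop es → incidences x es ≡ sum (λ w → multiplicity (x , w) es)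
incidences-sum {n} x [] = sym (sum-replicate-zero n)
incidences-sum x {(u , v) ∷ es} (u≢v ∷ ds) = trans
  (cong₂ _+_ (incidences-of-edge x u v u≢v) (incidences-sum x ds))
  (sym (∑-distrib-+ (λ w → 𝟙 ((x , w) ≈ᴱ? (u , v))) (λ w → multiplicity (x , w) es)))

cardinality-sum : ∀ {n} (f : Fin n → Bool) → ∣ tabulate f ∣ ≡ sum (𝔟 ∘ f)
cardinality-sum {zero}  f = refl
cardinality-sum {suc n} f with f zero
... | true  = cong suc (cardinality-sum (f ∘ suc))
... | false = cardinality-sum (f ∘ suc)

edgeList-non-loops : (G : Graph n) → All NonLoop (edgeList G)
edgeList-non-loops G = All.map Finₚ.<⇒≢ (edgeList-ordered G)

incidences-degree : (G : Graph n) (x : Fin n) → incidences x (edgeList G) ≡ degree G x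
incidences-degree G x = trans (incidences-sum x (edgeList-non-loops G))
  (trans (sum-cong-≗ (edgeList-multiplicity G x)) (sym (cardinality-sum (edge G x))))

-- All edges of `G` are taken red and all edges of `H` blue. Common edges form parallel pairs and
-- leave the surplus unchanged, and equality of degrees is exactly the balance of red and blue ends
-- that `join` requires.
linking-circuits : (G H : Graph n) → (∀ v → degree G v ≡ degree H v) → ∃ λ D → Links red blue G H D
linking-circuits {n} G H same-degrees = F , linking λ u v → begin
    𝔟 (edge G u v) + ∥ F ∥* (δ blue u v)     ≡⟨ cong (𝔟 (edge G u v) +_) (trans (eq (δ blue u v)) (trans (∥++∥ᵖ Gs Hs (δ blue u v))
                                                  (cong₂ _+_ (Gs-count blue u v) (Hs-count blue u v)))) ⟩
    𝔟 (edge G u v) + 𝔟 (edge H u v)          ≡⟨ +-comm (𝔟 (edge G u v)) _ ⟩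
    𝔟 (edge H u v) + 𝔟 (edge G u v)          ≡⟨ cong (𝔟 (edge H u v) +_) (sym (trans (eq (δ red u v)) (trans (∥++∥ᵖ Gs Hs (δ red u v))
                                                  (trans (cong₂ _+_ (Gs-count red u v) (Hs-count red u v)) (+-identityʳ _))))) ⟩
    𝔟 (edge H u v) + ∥ F ∥* (δ red u v)      ∎
  where
  open ≡-Reasoning
  Gs Hs : List (Piece n)
  Gs = edge-pieces rb (edgeList-non-loops G)
  Hs = edge-pieces br (edgeList-non-loops H)
  Gs-count : ∀ ι u v → ∥ Gs ∥ᵖ (δ ι u v) ≡ matching ι red (𝔟 (edge G u v))
  Gs-count ι u v = trans (edge-pieces-count ι rb u v (edgeList-non-loops G)) (cong (matching ι red) (edgeList-multiplicity G u v))
  Hs-count : ∀ ι u v → ∥ Hs ∥ᵖ (δ ι u v) ≡ matching ι blue (𝔟 (edge H u v))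
  Hs-count ι u v = trans (edge-pieces-count ι br u v (edgeList-non-loops H)) (cong (matching ι blue) (edgeList-multiplicity H u v))
  balanced : Balanced (Gs ++ Hs)
  balanced x = begin
    ends red blue x (Gs ++ Hs)                   ≡⟨ ends-++ red blue x Gs ⟩
    ends red blue x Gs + ends red blue x Hs      ≡⟨ cong₂ _+_ (trans (edge-pieces-ends rb x (edgeList-non-loops G)) (incidences-degree G x))
                                                              (edge-pieces-no-ends br x (edgeList-non-loops H)) ⟩
    degree G x + 0                               ≡⟨ +-identityʳ _ ⟩
    degree G x                                   ≡⟨ same-degrees x ⟩
    degree H x                                   ≡⟨ sym (cong₂ _+_ (edge-pieces-no-ends rb x (edgeList-non-loops G))
                                                              (trans (edge-pieces-ends br x (edgeList-non-loops H)) (incidences-degree H x))) ⟩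
    ends blue red x Gs + ends blue red x Hs      ≡⟨ sym (ends-++ blue red x Gs) ⟩
    ends blue red x (Gs ++ Hs)                   ∎
  F : List (Circuit n)
  F = proj₁ (join _ (Gs ++ Hs) ≤-refl balanced)
  eq : ∀ f → ∥ F ∥* f ≡ ∥ Gs ++ Hs ∥ᵖ f
  eq = proj₂ (join _ (Gs ++ Hs) ≤-refl balanced)

-- The distance formula

open import Data.Integer using (+_; _-_)

-- The division is exact because `e` is even, and the integer difference does not truncate.
half-difference : ∀ {e} k m → e ≡ 2 * (k + m) → + k ≡ + (e / 2) - + m
half-difference {e} k m e≡ = sym (begin
  + (e / 2) - + m          ≡⟨ cong (λ z → + z - + m) (trans (cong (_/ 2) (trans e≡ (*-comm 2 (k + m)))) (m*n/n≡m (k + m) 2)) ⟩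
  + (k + m) - + m          ≡⟨ ℤₚ.m-n≡m⊖n (k + m) m ⟩
  (k + m) ℤ.⊖ m            ≡⟨ ℤₚ.⊖-≥ (m≤n+m m k) ⟩
  + (k + m ∸ m)   ≡⟨ cong +_ (m+n∸n≡m k m) ⟩
  + k                      ∎)
  where open ≡-Reasoning

theorem3p6 : ∀ (n : ℕ) (d : Fin n → ℕ) → (∀ i → 0 < d i) →
    ∀ (G₁ G₂ : Graph n) → G₁ Realizes d → G₂ Realizes d →
    ∃₂ λ dist maxC →
    IsDist G₁ G₂ dist ×
    IsMaxC (redBlue G₁ G₂) maxC ×
    + dist ≡ + H′ G₁ G₂ - + maxC
theorem3p6 n d _ G₁ G₂ realizes₁ realizes₂
  with _ , links₀ ← linking-circuits G₁ G₂ (λ v → trans (realizes₁ v) (sym (realizes₂ v)))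
  -- The length of this sequence is irrelevant; it only bounds the search for a shortest one.
  with reach σ₀ _ ← reachable _ rb links₀
  with k , σ , minimal ← least (λ k → sequence? k G₁ G₂) _ σ₀
  = k , m , (σ , minimal) , (circuits⇒decomposition links′ reduced , maximal) , half-difference k m (≤-antisym upper lower)
  where
  open Conversion G₁ G₂
  open SwapCircuits (swap-circuits σ)
  open Reduction (reduce rb circuits links) renaming (links to links′)
  -- The circuits of a shortest sequence reduce to a decomposition, which turns out to be a largest
  -- one.
  m = length result
  E = ∣E∣ (G₁ △ G₂)

  -- Every linking family, in particular every decomposition, yields a sequence, and none is shorter
  -- than `k`.
  bound-by-dist : ∀ D → Links red blue G₁ G₂ D → 2 * (k + length D) ≤ ∥ D ∥* one
  bound-by-dist D links with reach {j} σⱼ le ← reachable D rb links =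
    ≤-trans (*-monoʳ-≤ 2 (+-monoˡ-≤ (length D) (minimal j σⱼ))) le

  lower : 2 * (k + m) ≤ E
  lower = ≤-trans (bound-by-dist result links′) (≤-reflexive (reduced-size links′ reduced))

  -- Before reduction there are `k` circuits and `4k` edges, so edges minus twice the circuits is
  -- `2k`; afterwards it is `E - 2m`, which is no larger.
  upper : E ≤ 2 * (k + m)
  upper = +-cancelʳ-≤ (2 * k) _ _ (begin
    E + 2 * k                            ≡⟨ cong₂ (λ e l → e + 2 * l) (sym (reduced-size links′ reduced)) (sym count) ⟩
    ∥ result ∥* one + 2 * length circuits ≤⟨ bound ⟩
    ∥ circuits ∥* one + 2 * m            ≡⟨ cong (_+ 2 * m) size-eq ⟩
    k * 4 + 2 * m                        ≡⟨ solve 2 (λ k m → k :* con 4 :+ con 2 :* m := con 2 :* (k :+ m) :+ con 2 :* k) refl k m ⟩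
    2 * (k + m) + 2 * k                  ∎)
    where open ≤-Reasoning

  maximal : ∀ X → size (redBlue G₁ G₂) X ≤ m
  maximal X with D , links , count-D , size-D ← decomposition⇒circuits X =
    +-cancelˡ-≤ k _ _ (*-cancelˡ-≤ 2 (begin
      2 * (k + size (redBlue G₁ G₂) X)   ≡⟨ cong (λ l → 2 * (k + l)) (sym count-D) ⟩
      2 * (k + length D)                 ≤⟨ bound-by-dist D links ⟩
      ∥ D ∥* one                         ≡⟨ size-D ⟩
      E                                  ≤⟨ upper ⟩
      2 * (k + m)                        ∎))
    where open ≤-Reasoning
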